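{- No inter-available-independent algorithm can achieve a competitive ratio better than $2-\sqrt2$ for the fractional fully online matching problem, even on bipartite graphs. That is, for every $\Gamma>2-\sqrt2$ there is no inter-available-independent online algorithm that is $\Gamma$-competitive for fractional fully online matching on all instances with bipartite underlying graph.
   Context: **Fractional fully online matching.** An instance is a finite simple graph $G=(V,E)$ in which each vertex $v$ has an arrival time $r_v$ and a deadline $d_v\ge r_v$; $v$ is available during $[r_v,d_v]$. Two vertices $u,v$ may be adjacent only if $[r_u,d_u]$ and $[r_v,d_v]$ intersect. Arrivals and deadlines are processed one at a time in chronological order (simultaneous events in some fixed order in which both endpoints of every edge have arrived before either of them reaches its deadline). The graph is not known in advance: when $v$ arrives, the algorithm learns of $v$ and of the edges from $v$ to previously arrived vertices; when $v$ reaches its deadline, the algorithm is notified that this is the last opportunity to match $v$. An online algorithm maintains values $x_{uv}\ge 0$, $(u,v)\in E$, initially $0$, subject to $\sum_{v:(u,v)\in E}x_{uv}\le 1$ for all $u$; it may only increase $x_{uv}$, and only while both $u$ and $v$ are available, and its decisions may depend only on the information revealed so far (and, if it is randomized, on its own random bits). The value of the output is $\sum_{(u,v)\in E}x_{uv}$ (in expectation, for a randomized algorithm). $\mathrm{OPT}(G)$ is the maximum of $\sum_{(u,v)\in E}x_{uv}$ over all $x\ge0$ with $\sum_{v:(u,v)\in E}x_{uv}\le1$ for all $u$. An algorithm is $\Gamma$-competitive on a class of instances if on every instance in the class its output has value at least $\Gamma\cdot\mathrm{OPT}(G)$. **Inter-available-independent algorithms.** An algorithm is inter-available-independent if it ignores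 edges between two available vertices that have not yet reached their deadlines; equivalently, the edges are regarded as being revealed to the algorithm only when one of their endpoints reaches its deadline. -}

module Defs where

open import Level using (Level; _⊔_) renaming (suc to lsuc)
open import Algebra.Bundles using (CommutativeRing)
open import Data.Bool using (Bool; true; false; T; if_then_else_)
open import Data.Fin using (Fin; toℕ; _<_; _≤_)
open import Data.Fin.Properties using (_<?_; _≤?_)
open import Data.List using (List; []; _∷_; map; filter; allFin)
open import Data.List.Membership.DecPropositional using (_∈?_)
open import Data.Nat as ℕ using (ℕ)
import Data.Nat.Properties as ℕₚ
open import Data.Product using (∃; ∃-syntax; _×_; _,_)
open import Function using (_∘_)
open import Function.Bundles using (_↔_; module Inverse)
open import Relation.Binary.Core using (Rel)
open import Relation.Binary.Definitions using (Cotransitive)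
open import Relation.Binary.PropositionalEquality using (_≡_; _≢_)
open import Relation.Binary.Structures using (IsStrictPartialOrder)
open import Relation.Nullary using (¬_; does)
open import Relation.Nullary.Decidable using (T?; _×-dec_; _⊎-dec_)
import Algebra.Definitions.RawMonoid
import Algebra.Properties.CommutativeMonoid.Sum

-- The real numbers, axiomatised as a Cauchy-complete Archimedean ordered
-- field.  The order axioms are the constructive ones (cotransitivity in place
-- of trichotomy), so that both the classical reals and the constructive Cauchy
-- reals, with setoid equality, are models.

record RealField (c ℓ₁ ℓ₂ : Level) : Set (lsuc (c ⊔ ℓ₁ ⊔ ℓ₂)) where
  field
    commutativeRing : CommutativeRing c ℓ₁

  open CommutativeRing commutativeRing public
    renaming (Carrier to ℝ)
  open Algebra.Definitions.RawMonoid +-rawMonoid public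
    using () renaming (_×_ to _·_)

  infix 4 _<ᵣ_ _≤ᵣ_

  field
    _<ᵣ_                 : Rel ℝ ℓ₂
    isStrictPartialOrder : IsStrictPartialOrder _≈_ _<ᵣ_
    <-cotransitive       : Cotransitive _<ᵣ_
    <-tight              : ∀ {x y} → ¬ x <ᵣ y → ¬ y <ᵣ x → x ≈ y
    0<1                  : 0# <ᵣ 1#
    +-monoˡ-<            : ∀ {x y} z → x <ᵣ y → x + z <ᵣ y + z
    *-pos                : ∀ {x y} → 0# <ᵣ x → 0# <ᵣ y → 0# <ᵣ x * y
    positive-invertible  : ∀ {x} → 0# <ᵣ x → ∃[ y ] x * y ≈ 1#
    archimedean          : ∀ x → ∃[ n ] x <ᵣ n · 1#

  Cauchy : (ℕ → ℝ) → Set (c ⊔ ℓ₂)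
  Cauchy s = ∀ ε → 0# <ᵣ ε →
    ∃[ N ] (∀ m n → N ℕ.≤ m → N ℕ.≤ n → s m - s n <ᵣ ε)

  _ConvergesTo_ : (ℕ → ℝ) → ℝ → Set (c ⊔ ℓ₂)
  s ConvergesTo l = ∀ ε → 0# <ᵣ ε →
    ∃[ N ] (∀ n → N ℕ.≤ n → (s n - l <ᵣ ε) × (l - s n <ᵣ ε))

  field
    complete : ∀ s → Cauchy s → ∃[ l ] s ConvergesTo l

  _≤ᵣ_ : Rel ℝ ℓ₂
  x ≤ᵣ y = ¬ y <ᵣ x


-- A probability space, presented by the expectation on its integrable random
-- variables.  Only linearity, positivity and normalisation are required, so
-- every probability measure is covered (with Integrable meaning L¹), and
-- the one-point space gives the deterministic algorithms.

record ProbabilitySpace {c ℓ₁ ℓ₂} (R : RealField c ℓ₁ ℓ₂) (a p : Level)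
    : Set (c ⊔ ℓ₁ ⊔ ℓ₂ ⊔ lsuc (a ⊔ p)) where
  open RealField R
  field
    Ω          : Set a
    Integrable : (Ω → ℝ) → Set p

    integrable-cong  : ∀ {X Y} → (∀ ω → X ω ≈ Y ω) → Integrable X → Integrable Y
    integrable-const : ∀ r → Integrable (λ _ → r)
    integrable-+     : ∀ {X Y} → Integrable X → Integrable Y →
                       Integrable (λ ω → X ω + Y ω)
    integrable-*     : ∀ r {X} → Integrable X → Integrable (λ ω → r * X ω)

    𝔼       : (X : Ω → ℝ) → Integrable X → ℝ
    𝔼-const : ∀ r i → 𝔼 (λ _ → r) i ≈ r
    𝔼-+     : ∀ {X Y} i j k → 𝔼 (λ ω → X ω + Y ω) k ≈ 𝔼 X i + 𝔼 Y j
    𝔼-*     : ∀ r {X} i j → 𝔼 (λ ω → r * X ω) j ≈ r * 𝔼 X i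
    𝔼-mono  : ∀ {X Y} i j → (∀ ω → X ω ≤ᵣ Y ω) → 𝔼 X i ≤ᵣ 𝔼 Y j


record Graph (n : ℕ) : Set where
  field
    adj       : Fin n → Fin n → Bool
    symmetric : ∀ u v → adj u v ≡ adj v u
    loopless  : ∀ v → adj v v ≡ false

  Edge : Fin n → Fin n → Set
  Edge u v = T (adj u v)

BipartiteGraph : ∀ {n} → Graph n → Set
BipartiteGraph {n} G =
  ∃ λ (side : Fin n → Bool) → ∀ u v → Edge u v → side u ≢ side v
  where open Graph G

data Event (n : ℕ) : Set where
  arrival deadline : Fin n → Event n

Event-rec : ∀ {n ℓ} {A : Set ℓ} → (Fin n → A) → (Fin n → A) → Event n → A
Event-rec f g (arrival v)  = f v
Event-rec f g (deadline v) = g v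


module FullyOnline {c ℓ₁ ℓ₂} (R : RealField c ℓ₁ ℓ₂) where

  open RealField R
  open Algebra.Properties.CommutativeMonoid.Sum +-commutativeMonoid using (sum)

  module _ {n : ℕ} (G : Graph n) where
    open Graph G

    -- An edge weighting is a symmetric matrix vanishing off the edges, so the
    -- sum over all v is the sum over the neighbours of u.
    record IsFractionalMatching (x : Fin n → Fin n → ℝ) : Set (ℓ₁ ⊔ ℓ₂) where
      field
        symm     : ∀ u v → x u v ≈ x v u
        support  : ∀ u v → ¬ Edge u v → x u v ≈ 0#
        nonneg   : ∀ u v → 0# ≤ᵣ x u v
        capacity : ∀ u → sum (λ v → x u v) ≤ᵣ 1#

  -- Each unordered pair {u , v} is counted once.
  value : ∀ {n} → (Fin n → Fin n → ℝ) → ℝ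
  value x = sum λ u → sum λ v → if does (u <? v) then x u v else 0#

  IsOPT : ∀ {n} → Graph n → ℝ → Set (c ⊔ ℓ₁ ⊔ ℓ₂)
  IsOPT G opt = (∃[ x ] IsFractionalMatching G x × value x ≈ opt)
              × (∀ x → IsFractionalMatching G x → value x ≤ᵣ opt)

  -- `order` lists all events in the order in which they are processed; it is
  -- part of the instance because the times need not be distinct.
  record Instance : Set (c ⊔ ℓ₂) where
    field
      n     : ℕ
      graph : Graph n
      r d   : Fin n → ℝ
      order : Event n ↔ Fin (n ℕ.+ n)

    open Graph graph public

    time : Event n → ℝ
    time = Event-rec r d

    position : Event n → Fin (n ℕ.+ n)
    position = Inverse.to order

    event : Fin (n ℕ.+ n) → Event n
    event = Inverse.from order

    field
      r≤d            : ∀ v → r v ≤ᵣ d v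
      intersecting   : ∀ u v → Edge u v → (r u ≤ᵣ d v) × (r v ≤ᵣ d u)
      chronological  : ∀ e f → position e < position f → time e ≤ᵣ time f
      arrival-first  : ∀ v → position (arrival v) < position (deadline v)
      edge-available : ∀ u v → Edge u v →
                       position (arrival u) < position (deadline v)

    -- A vertex is still available while its own deadline event is processed.
    Available : Fin n → Fin (n ℕ.+ n) → Set
    Available v i = (position (arrival v) ≤ i) × (i ≤ position (deadline v))

  Bipartite : Instance → Set
  Bipartite I = BipartiteGraph (Instance.graph I)

  -- What the algorithm is told at an event: its time, the name of the vertex,
  -- and, at an arrival, the names of the previously arrived neighbours.
  -- Names are arbitrary (the number of vertices is not disclosed).
  data Observation : Set c where
    arrives : (t : ℝ) (v : ℕ) (neighbours : List ℕ) → Observation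
    expires : (t : ℝ) (v : ℕ) → Observation

  History : Set c
  History = List Observation

  module _ (I : Instance) where
    open Instance I

    earlierNeighbours : Fin n → List (Fin n)
    earlierNeighbours v =
      filter (λ u → T? (adj v u) ×-dec (position (arrival u) <? position (arrival v)))
             (allFin n)

    observe : Event n → Observation
    observe (arrival v)  = arrives (r v) (toℕ v) (map toℕ (earlierNeighbours v))
    observe (deadline v) = expires (d v) (toℕ v)

    -- The information revealed up to and including event i, oldest first.
    history : Fin (n ℕ.+ n) → History
    history i = map (observe ∘ event) (filter (_≤? i) (allFin (n ℕ.+ n)))

  expired : History → List ℕ
  expired []                   = []
  expired (arrives _ _ _ ∷ h) = expired h
  expired (expires _ v   ∷ h) = v ∷ expired h

  -- Deletes the edges neither of whose endpoints has reached its deadline.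
  hide : History → History
  hide h = map conceal h
    where
    reached? = λ v → _∈?_ ℕₚ._≟_ v (expired h)

    conceal : Observation → Observation
    conceal (arrives t v us) =
      arrives t v (filter (λ u → reached? v ⊎-dec reached? u) us)
    conceal (expires t v)    = expires t v

  module _ {a p} (P : ProbabilitySpace R a p) where
    open ProbabilitySpace P

    -- `increase ω h u v` is the amount by which x_uv is raised right after the
    -- last event of h.  Raising values only at events is no restriction: both
    -- endpoints of an edge available between two events are still available
    -- while the next event is processed.  The increments being nonnegative, it
    -- also suffices to impose the capacity constraint on the final values.
    record OnlineAlgorithm {q} (Class : Instance → Set q)
        : Set (c ⊔ ℓ₁ ⊔ ℓ₂ ⊔ a ⊔ p ⊔ q) where
      field
        increase : Ω → History → ℕ → ℕ → ℝ

      increment : Ω → (I : Instance) (let open Instance I) →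
                  Fin (n ℕ.+ n) → Fin n → Fin n → ℝ
      increment ω I i u v = increase ω (history I i) (toℕ u) (toℕ v)

      output : Ω → (I : Instance) (let open Instance I) → Fin n → Fin n → ℝ
      output ω I u v = sum λ i → increment ω I i u v

      field
        nonneg     : ∀ ω I (let open Instance I) → Class I →
                     ∀ i u v → 0# ≤ᵣ increment ω I i u v
        available  : ∀ ω I (let open Instance I) → Class I →
                     ∀ i u v → ¬ (Edge u v × Available u i × Available v i) →
                     increment ω I i u v ≈ 0#
        feasible   : ∀ ω I (let open Instance I) → Class I →
                     IsFractionalMatching graph (output ω I)
        integrable : ∀ I (let open Instance I) → Class I →
                     ∀ i u v → Integrable (λ ω → increment ω I i u v)

    integrable-sum : ∀ {m} (X : Ω → Fin m → ℝ) →
                     (∀ i → Integrable (λ ω → X ω i)) →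
                     Integrable (λ ω → sum (X ω))
    integrable-sum {ℕ.zero}  X int = integrable-const 0#
    integrable-sum {ℕ.suc m} X int =
      integrable-+ (int Fin.zero) (integrable-sum (λ ω i → X ω (Fin.suc i)) (int ∘ Fin.suc))

    integrable-value : ∀ {m} (x : Ω → Fin m → Fin m → ℝ) →
                       (∀ u v → Integrable (λ ω → x ω u v)) →
                       Integrable (λ ω → value (x ω))
    integrable-value x int =
      integrable-sum _ λ u → integrable-sum _ λ v → select (does (u <? v)) (int u v)
      where
      select : ∀ b {X} → Integrable X → Integrable (λ ω → if b then X ω else 0#)
      select true  i = i
      select false _ = integrable-const 0#

    module _ {q} {Class : Instance → Set q} (A : OnlineAlgorithm Class) where
      open OnlineAlgorithm A

      InterAvailableIndependent : Set (c ⊔ ℓ₁ ⊔ a)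
      InterAvailableIndependent =
        ∀ ω h u v → increase ω h u v ≈ increase ω (hide h) u v

      expectedValue : ∀ I → Class I → ℝ
      expectedValue I C = 𝔼 (λ ω → value (output ω I))
        (integrable-value (λ ω → output ω I) λ u v →
          integrable-sum (λ ω i → increment ω I i u v) λ i → integrable I C i u v)

      Competitive : ℝ → Set (c ⊔ ℓ₁ ⊔ ℓ₂ ⊔ q)
      Competitive Γ = ∀ I (C : Class I) opt → IsOPT (Instance.graph I) opt →
        Γ * opt ≤ᵣ expectedValue I C

{- The adversary plays a token game.  Every vertex carries a weight w / M (0 once it is of no
further use), and a move takes a vertex u of weight (M - i) / M together with a pool of i + 1
vertices of weight i / M on the other side.  The vertices of the pool become the neighbours of
u, and the deadline of u is processed next.  Afterwards u gets weight 0, the vertex of the pool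
that is matched least so far gets weight 0 and becomes the partner of u in the optimum, and the
other i vertices of the pool get weight (i + 1) / M; this preserves the total weight of the pool.

By the capacity constraint of u and the choice of the dropped vertex, the value obtained so far
plus the sum of weight times residual capacity never increases, so the value is at most the
initial total weight.  Every move adds 1 to the optimum.  As edges stay hidden until a deadline,
the rows of the expected output belonging to past deadlines are determined by the moves made so
far, which is what lets the adversary adapt.

For r + s = M with M (M + 1) = 2 s (s + 1) the moves can be made at stationary rates: apart from
a fixed stock, only fresh vertices of weight r / M are consumed, two per move.  The ratio then
tends to 2 r / M = 2 - 2 s / M, and solutions of this Pell equation bring 2 s / M to √2. -}
module Submission where

open import Defs
import Data.Nat.Properties as ℕₚ
open import Level using (Level; _⊔_)
open import Data.Bool as Bool using (Bool; true; false; if_then_else_; T; not; _∧_; _∨_)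
open import Data.Empty using (⊥; ⊥-elim)
open import Data.Fin using (Fin; zero; suc; toℕ; fromℕ<; _↑ˡ_; _↑ʳ_; splitAt; join)
open import Data.Fin.Permutation using (Permutation′; _⟨$⟩ʳ_; _⟨$⟩ˡ_; _∘ₚ_; inverseʳ; inverseˡ)
open import Data.Fin.Permutation.Components using (transpose)
open import Data.Fin.Properties
  using (_≟_; _<?_; <-cmp; toℕ-fromℕ<; toℕ-injective; toℕ<n; toℕ-↑ˡ; toℕ-↑ʳ;
         splitAt-↑ˡ; splitAt-↑ʳ; join-splitAt)
open import Data.List using (List; []; _∷_; map; filter; allFin)
open import Data.List.Membership.DecPropositional ℕₚ._≟_ using (_∈?_)
open import Data.List.Membership.Propositional using (_∈_)
open import Data.List.Properties using (map-cong; map-∘; map-cong-local)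
open import Data.List.Relation.Unary.All as All using (All; []; _∷_)
open import Data.List.Relation.Unary.All.Properties using (all-filter)
open import Data.Nat as ℕ using (ℕ; zero; suc; z≤n; s≤s; _∸_; _!)
open import Data.Nat.Divisibility using (∣-trans; m∣m*n; m≤n⇒m!∣n!)
open import Data.Nat.DivMod using (m*[n/m]≡n)
open import Data.Product using (Σ; ∃; _×_; _,_; proj₁; proj₂)
open import Data.Sum using (_⊎_; inj₁; inj₂; [_,_]′)
open import Data.Unit using (tt)
open import Function using (_∘_)
open import Function.Bundles using (mk↔ₛ′)
open import Relation.Binary.Bundles using (Poset)
open import Relation.Binary.Definitions using (tri<; tri≈; tri>)
open import Relation.Binary.PropositionalEquality as ≡ using (_≡_; _≢_)
open import Relation.Binary.Structures using (IsStrictPartialOrder)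
open import Relation.Nullary using (¬_; Dec; yes; no; does)
open import Relation.Nullary.Decidable
  using (dec-true; dec-false; ¬¬-excluded-middle; T?; _×-dec_; _⊎-dec_)
open import Relation.Unary using (Decidable)
import Algebra.Properties.CommutativeMonoid.Sum
import Algebra.Properties.Monoid.Mult
import Algebra.Properties.Semiring.Mult
import Algebra.Properties.Semiring.Sum
import Algebra.Solver.Ring.NaturalCoefficients.Default
import Data.Bool.Properties as Boolₚ
import Data.Fin.Permutation as Perm
import Data.Fin.Properties as Finₚ
import Data.Nat.Solver
import Data.Vec.Functional as Vector
import Relation.Binary.Reasoning.PartialOrder

open Algebra.Properties.Semiring.Sum ℕₚ.+-*-semiring
  using ()
  renaming (sum to sumℕ; sum-cong-≗ to sumℕ-cong; ∑-distrib-+ to sumℕ-distrib-+;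
            *-distribˡ-sum to *-distribˡ-sumℕ; sum-replicate-zero to sumℕ-zero;
            sum-permute to sumℕ-permute)

-- Ordered-field arithmetic, numerals and finite sums.

module OrderedField {c ℓ₁ ℓ₂} (R : RealField c ℓ₁ ℓ₂) where

  open RealField R hiding (zero)
  open IsStrictPartialOrder isStrictPartialOrder public
    using () renaming (irrefl to <-irrefl; trans to <-trans; asym to <-asym;
                       <-respˡ-≈ to <-respˡ; <-respʳ-≈ to <-respʳ)
  open Algebra.Properties.Semiring.Sum semiring public
    using (*-distribˡ-sum; sum-cong-≋; ∑-distrib-+; ∑-comm; sum-replicate-zero)
  open Algebra.Properties.CommutativeMonoid.Sum +-commutativeMonoid public using (sum)
  open Algebra.Properties.Monoid.Mult +-monoid public using (×-homo-+)
  open Algebra.Properties.Semiring.Mult semiring public using (×1-homo-*)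

  module Solver = Algebra.Solver.Ring.NaturalCoefficients.Default commutativeSemiring

  ≤-reflexive : ∀ {x y} → x ≈ y → x ≤ᵣ y
  ≤-reflexive x≈y = <-irrefl (sym x≈y)

  ≤-refl : ∀ {x} → x ≤ᵣ x
  ≤-refl = ≤-reflexive refl

  -- As `≤ᵣ` negates the reverse strict order, a supposed `z <ᵣ x` is split at `y` by
  -- cotransitivity.
  ≤-trans : ∀ {x y z} → x ≤ᵣ y → y ≤ᵣ z → x ≤ᵣ z
  ≤-trans {y = y} x≤y y≤z z<x with <-cotransitive z<x y
  ... | inj₁ z<y = y≤z z<y
  ... | inj₂ y<x = x≤y y<x

  ≤-antisym : ∀ {x y} → x ≤ᵣ y → y ≤ᵣ x → x ≈ y
  ≤-antisym x≤y y≤x = <-tight y≤x x≤y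

  <⇒≤ : ∀ {x y} → x <ᵣ y → x ≤ᵣ y
  <⇒≤ = <-asym

  <-≤-trans : ∀ {x y z} → x <ᵣ y → y ≤ᵣ z → x <ᵣ z
  <-≤-trans {z = z} x<y y≤z with <-cotransitive x<y z
  ... | inj₁ x<z = x<z
  ... | inj₂ z<y = ⊥-elim (y≤z z<y)

  ≤-<-trans : ∀ {x y z} → x ≤ᵣ y → y <ᵣ z → x <ᵣ z
  ≤-<-trans {x = x} x≤y y<z with <-cotransitive y<z x
  ... | inj₁ y<x = ⊥-elim (x≤y y<x)
  ... | inj₂ x<z = x<z

  ≤-poset : Poset _ _ _
  ≤-poset = record
    { Carrier = ℝ ; _≈_ = _≈_ ; _≤_ = _≤ᵣ_
    ; isPartialOrder = record
      { isPreorder = record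
        { isEquivalence = isEquivalence ; reflexive = ≤-reflexive ; trans = ≤-trans }
      ; antisym = ≤-antisym } }

  module ≤-Reasoning = Relation.Binary.Reasoning.PartialOrder ≤-poset

  +-cancelʳ-< : ∀ z {x y} → x + z <ᵣ y + z → x <ᵣ y
  +-cancelʳ-< z {x} {y} lt = <-respˡ (cancel x) (<-respʳ (cancel y) (+-monoˡ-< (- z) lt))
    where
    cancel : ∀ x → x + z + - z ≈ x
    cancel x = trans (+-assoc x z (- z)) (trans (+-congˡ (-‿inverseʳ z)) (+-identityʳ x))

  +-monoˡ-≤ : ∀ z {x y} → x ≤ᵣ y → x + z ≤ᵣ y + z
  +-monoˡ-≤ z x≤y = x≤y ∘ +-cancelʳ-< z

  +-cancelʳ-≤ : ∀ z {x y} → x + z ≤ᵣ y + z → x ≤ᵣ y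
  +-cancelʳ-≤ z le = le ∘ +-monoˡ-< z

  +-monoʳ-≤ : ∀ z {x y} → x ≤ᵣ y → z + x ≤ᵣ z + y
  +-monoʳ-≤ z {x} {y} x≤y =
    ≤-trans (≤-reflexive (+-comm z x)) (≤-trans (+-monoˡ-≤ z x≤y) (≤-reflexive (+-comm y z)))

  +-mono-≤ : ∀ {x y u v} → x ≤ᵣ y → u ≤ᵣ v → x + u ≤ᵣ y + v
  +-mono-≤ {y = y} {u = u} x≤y u≤v = ≤-trans (+-monoˡ-≤ u x≤y) (+-monoʳ-≤ y u≤v)

  x≤x+y : ∀ {x y} → 0# ≤ᵣ y → x ≤ᵣ x + y
  x≤x+y {x} 0≤y = ≤-trans (≤-reflexive (sym (+-identityʳ x))) (+-monoʳ-≤ x 0≤y)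

  x≤y+x : ∀ {x y} → 0# ≤ᵣ y → x ≤ᵣ y + x
  x≤y+x {x} 0≤y = ≤-trans (≤-reflexive (sym (+-identityˡ x))) (+-monoˡ-≤ x 0≤y)

  x<y⇒0<y-x : ∀ {x y} → x <ᵣ y → 0# <ᵣ y - x
  x<y⇒0<y-x {x} lt = <-respˡ (-‿inverseʳ x) (+-monoˡ-< (- x) lt)

  x-y+y≈x : ∀ x y → x - y + y ≈ x
  x-y+y≈x x y = trans (+-assoc x (- y) y) (trans (+-congˡ (-‿inverseˡ y)) (+-identityʳ x))

  *-monoˡ-< : ∀ {z x y} → 0# <ᵣ z → x <ᵣ y → z * x <ᵣ z * y
  *-monoˡ-< {z} {x} {y} 0<z x<y =
    <-respˡ (+-identityˡ _) (<-respʳ expand (+-monoˡ-< (z * x) (*-pos 0<z (x<y⇒0<y-x x<y))))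
    where
    expand : z * (y - x) + z * x ≈ z * y
    expand = trans (sym (distribˡ z _ _)) (*-congˡ (x-y+y≈x y x))

  ι : ℕ → ℝ
  ι k = k · 1#

  ι-suc-* : ∀ k x → ι (suc k) * x ≈ x + ι k * x
  ι-suc-* k x = trans (distribʳ x 1# (ι k)) (+-congʳ (*-identityˡ x))

  -- Multiplication by a numeral is repeated addition, so monotonicity of addition suffices. All
  -- vertex weights are numerals, which makes this the form needed for weighted sums.
  ι-*-mono : ∀ k {x y} → x ≤ᵣ y → ι k * x ≤ᵣ ι k * y
  ι-*-mono zero    {x} {y} x≤y = ≤-reflexive (trans (zeroˡ x) (sym (zeroˡ y)))
  ι-*-mono (suc k) {x} {y} x≤y =
    ≤-trans (≤-reflexive (ι-suc-* k x))
      (≤-trans (+-mono-≤ x≤y (ι-*-mono k x≤y)) (≤-reflexive (sym (ι-suc-* k y))))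

  0≤ι : ∀ k → 0# ≤ᵣ ι k
  0≤ι zero    = ≤-refl
  0≤ι (suc k) = ≤-trans (<⇒≤ 0<1) (x≤x+y (0≤ι k))

  ι-mono : ∀ {m n} → m ℕ.≤ n → ι m ≤ᵣ ι n
  ι-mono {n = n} z≤n = 0≤ι n
  ι-mono (s≤s p) = +-monoʳ-≤ 1# (ι-mono p)

  ι-pos : ∀ {n} → 0 ℕ.< n → 0# <ᵣ ι n
  ι-pos {suc n} _ = <-≤-trans 0<1 (x≤x+y (0≤ι n))

  ι-+ : ∀ m n → ι (m ℕ.+ n) ≈ ι m + ι n
  ι-+ = ×-homo-+ 1#

  ι-* : ∀ m n → ι (m ℕ.* n) ≈ ι m * ι n
  ι-* = ×1-homo-*

  ι-cong : ∀ {m n} → m ≡ n → ι m ≈ ι n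
  ι-cong ≡.refl = refl

  sum-mono : ∀ {n} {f g : Fin n → ℝ} → (∀ i → f i ≤ᵣ g i) → sum f ≤ᵣ sum g
  sum-mono {zero}  le = ≤-refl
  sum-mono {suc n} le = +-mono-≤ (le zero) (sum-mono (le ∘ suc))

  sum-zero : ∀ {n} {f : Fin n → ℝ} → (∀ i → f i ≈ 0#) → sum f ≈ 0#
  sum-zero {n} f≈0 = trans (sum-cong-≋ f≈0) (sum-replicate-zero n)

  -- The shape of the summands of `value`; it also serves to restrict sums to a set of vertices.
  guard : Bool → ℝ → ℝ
  guard b x = if b then x else 0#

  guard-cong : ∀ b {x y} → x ≈ y → guard b x ≈ guard b y
  guard-cong true  eq = eq
  guard-cong false eq = refl

  guard-mono : ∀ b {x y} → x ≤ᵣ y → guard b x ≤ᵣ guard b y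
  guard-mono true  le = le
  guard-mono false le = ≤-refl

  guard-+ : ∀ b x y → guard b (x + y) ≈ guard b x + guard b y
  guard-+ true  x y = refl
  guard-+ false x y = sym (+-identityʳ 0#)

  guard-nonneg : ∀ b {x} → 0# ≤ᵣ x → 0# ≤ᵣ guard b x
  guard-nonneg true  le = le
  guard-nonneg false le = ≤-refl

  guard-0 : ∀ b → guard b 0# ≈ 0#
  guard-0 true  = refl
  guard-0 false = refl

  guard-sum : ∀ b {n} (f : Fin n → ℝ) → guard b (sum f) ≈ sum (λ i → guard b (f i))
  guard-sum true  f = refl
  guard-sum false f = sym (sum-zero {f = λ i → guard false (f i)} (λ _ → refl))

  sum-guard-≟ : ∀ {n} (u : Fin n) (f : Fin n → ℝ) → sum (λ v → guard (does (v ≟ u)) (f v)) ≈ f u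
  sum-guard-≟ (zero {n}) f = trans (+-congˡ (sum-zero {n} (λ _ → refl))) (+-identityʳ _)
  sum-guard-≟ (suc u) f = trans (+-identityˡ _) (sum-guard-≟ u (f ∘ suc))

-- Symmetric edge weightings: values, row sums, stars and covers.

module Matrices {c ℓ₁ ℓ₂} (R : RealField c ℓ₁ ℓ₂) {n : ℕ} where

  open RealField R hiding (zero)
  open OrderedField R
  open FullyOnline R using (value)

  Matrix : Set c
  Matrix = Fin n → Fin n → ℝ

  row : Matrix → Fin n → ℝ
  row x u = sum (x u)

  -- The symmetric matrix with `e y` on the pair of `u` and `y`: the change that a single move
  -- makes. `value` does not see the diagonal, hence the condition `e u ≈ 0#` in `value-star`.
  star : Fin n → (Fin n → ℝ) → Matrix
  star u e x y = guard (does (x ≟ u)) (e y) + guard (does (y ≟ u)) (e x)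

  value-cong : ∀ {x y : Matrix} → (∀ u v → x u v ≈ y u v) → value x ≈ value y
  value-cong eq = sum-cong-≋ λ u → sum-cong-≋ λ v → guard-cong (does (u <? v)) (eq u v)

  sum²-distrib-+ : ∀ (x y : Matrix) →
    sum (λ u → sum (λ v → x u v + y u v)) ≈ sum (λ u → sum (x u)) + sum (λ u → sum (y u))
  sum²-distrib-+ x y = trans (sum-cong-≋ {n} λ u → ∑-distrib-+ (x u) (y u)) (∑-distrib-+ (row x) (row y))

  value-+ : ∀ (x y : Matrix) → value (λ u v → x u v + y u v) ≈ value x + value y
  value-+ x y =
    trans (sum-cong-≋ λ u → sum-cong-≋ λ v → guard-+ (does (u <? v)) (x u v) (y u v))
          (sum²-distrib-+ _ _)

  row-star : ∀ u e x → row (star u e) x ≈ guard (does (x ≟ u)) (sum e) + e x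
  row-star u e x = trans (∑-distrib-+ (λ y → guard (does (x ≟ u)) (e y)) _)
    (+-cong (sym (guard-sum (does (x ≟ u)) e)) (sum-guard-≟ u (λ _ → e x)))

  guard-comm : ∀ a b x → guard a (guard b x) ≈ guard b (guard a x)
  guard-comm true  b x = refl
  guard-comm false b x = sym (guard-0 b)

  guard-<-split : ∀ (u v : Fin n) x → (u ≡ v → x ≈ 0#) →
    guard (does (u <? v)) x + guard (does (v <? u)) x ≈ x
  guard-<-split u v x x≈0 with <-cmp u v
  ... | tri< u<v _ v≮u rewrite dec-true (u <? v) u<v | dec-false (v <? u) v≮u = +-identityʳ x
  ... | tri> u≮v _ v<u rewrite dec-false (u <? v) u≮v | dec-true (v <? u) v<u = +-identityˡ x
  ... | tri≈ u≮v u≡v v≮u rewrite dec-false (u <? v) u≮v | dec-false (v <? u) v≮u =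
    trans (+-identityʳ 0#) (sym (x≈0 u≡v))

  guard-<-split-≤ : ∀ (u v : Fin n) {x} → 0# ≤ᵣ x →
    guard (does (u <? v)) x + guard (does (v <? u)) x ≤ᵣ x
  guard-<-split-≤ u v {x} 0≤x with u ≟ v
  ... | no u≢v = ≤-reflexive (guard-<-split u v x (⊥-elim ∘ u≢v))
  ... | yes ≡.refl rewrite dec-false (u <? u) (ℕₚ.<-irrefl ≡.refl) =
    ≤-trans (≤-reflexive (+-identityʳ 0#)) 0≤x

  -- Row `u` and column `u` are summed separately above the diagonal; for every `y ≢ u` exactly one
  -- of them contributes `e y`.
  value-star : ∀ u (e : Fin n → ℝ) → e u ≈ 0# → value (star u e) ≈ sum e
  value-star u e eu≈0 = begin-equality
    value (star u e)
      ≈⟨ (sum-cong-≋ λ x → sum-cong-≋ λ y → trans (guard-+ (does (x <? y)) _ _)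
            (+-cong (guard-comm (does (x <? y)) (does (x ≟ u)) (e y))
                    (guard-comm (does (x <? y)) (does (y ≟ u)) (e x)))) ⟩
    sum (λ x → sum λ y → guard (does (x ≟ u)) (out x y) + guard (does (y ≟ u)) (inn x y))
      ≈⟨ sum²-distrib-+ _ _ ⟩
    sum (λ x → sum λ y → guard (does (x ≟ u)) (out x y)) +
    sum (λ x → sum λ y → guard (does (y ≟ u)) (inn x y))
      ≈⟨ +-cong (trans (sum-cong-≋ λ x → sym (guard-sum (does (x ≟ u)) (out x)))
                       (sum-guard-≟ u (λ x → sum (out x))))
                (sum-cong-≋ λ x → sum-guard-≟ u (inn x)) ⟩
    sum (out u) + sum (λ x → inn x u)
      ≈⟨ ∑-distrib-+ (out u) (λ x → inn x u) ⟨
    sum (λ y → out u y + inn y u)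
      ≈⟨ (sum-cong-≋ λ y → guard-<-split u y (e y) λ { ≡.refl → eu≈0 }) ⟩
    sum e ∎
    where
    open ≤-Reasoning
    out inn : Matrix
    out x y = guard (does (x <? y)) (e y)
    inn x y = guard (does (x <? y)) (e x)

  -- The easy half of the duality between matchings and vertex covers: a nonzero entry has an
  -- endpoint in `cover` and is charged to the row of that endpoint.
  value-≤-cover : ∀ (x : Matrix) (cover : Fin n → Bool) →
    (∀ u v → x u v ≈ x v u) → (∀ u v → 0# ≤ᵣ x u v) →
    (∀ u v → cover u ≡ false → cover v ≡ false → x u v ≈ 0#) →
    value x ≤ᵣ sum (λ u → guard (cover u) (row x u))
  value-≤-cover x cover symm nonneg covered = begin
    value x
      ≤⟨ (sum-mono λ u → sum-mono λ v → split u v) ⟩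
    sum (λ u → sum λ v → lower u v + upper v u)
      ≈⟨ sum²-distrib-+ lower (λ u v → upper v u) ⟩
    sum (λ u → sum (lower u)) + sum (λ u → sum λ v → upper v u)
      ≈⟨ +-congˡ (∑-comm (λ u v → upper v u)) ⟩
    sum (λ u → sum (lower u)) + sum (λ u → sum (upper u))
      ≈⟨ sum²-distrib-+ lower upper ⟨
    sum (λ u → sum λ v → lower u v + upper u v)
      ≤⟨ (sum-mono λ u → sum-mono λ v →
            guard-<-split-≤ u v (guard-nonneg (cover u) (nonneg u v))) ⟩
    sum (λ u → sum λ v → guard (cover u) (x u v))
      ≈⟨ (sum-cong-≋ λ u → guard-sum (cover u) (x u)) ⟨
    sum (λ u → guard (cover u) (row x u)) ∎
    where
    open ≤-Reasoning
    -- The entry of a pair `u`, `v` with `u` before `v` is charged to `lower u v` in the row of `u`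
    -- or to `upper v u` in the row of `v`; the two halves of a row recombine after exchanging
    -- summations.
    lower upper : Matrix
    lower u v = guard (does (u <? v)) (guard (cover u) (x u v))
    upper u v = guard (does (v <? u)) (guard (cover u) (x u v))

    endpoint : ∀ u v → x u v ≤ᵣ guard (cover u) (x u v) + guard (cover v) (x v u)
    endpoint u v with cover u in cu | cover v in cv
    ... | true  | true  = x≤x+y (nonneg v u)
    ... | true  | false = x≤x+y ≤-refl
    ... | false | true  = ≤-trans (≤-reflexive (symm u v)) (x≤y+x ≤-refl)
    ... | false | false = ≤-reflexive (trans (covered u v cu cv) (sym (+-identityʳ 0#)))

    split : ∀ u v → guard (does (u <? v)) (x u v) ≤ᵣ lower u v + upper v u
    split u v = ≤-trans (guard-mono (does (u <? v)) (endpoint u v))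
                        (≤-reflexive (guard-+ (does (u <? v)) _ _))

-- Counting with Boolean predicates, and multisets of tokens.

bit : Bool → ℕ
bit b = if b then 1 else 0

count : ∀ {n} → (Fin n → Bool) → ℕ
count q = sumℕ (λ v → bit (q v))

count-choose : ∀ {n} (q : Fin n → Bool) k → k ℕ.≤ count q →
  ∃ λ (q′ : Fin n → Bool) → (∀ v → q′ v ≡ true → q v ≡ true) × count q′ ≡ k
count-choose {zero} q zero _ = q , (λ ()) , ≡.refl
count-choose {suc n} q k le with q zero in q0
count-choose {suc n} q (suc k) (s≤s le) | true
  with q′ , sub , eq ← count-choose (q ∘ suc) k le =
  (true Vector.∷ q′) , (λ { zero _ → q0 ; (suc v) → sub v }) , ≡.cong suc eq
count-choose {suc n} q zero le | true
  with q′ , sub , eq ← count-choose (q ∘ suc) 0 z≤n =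
  (false Vector.∷ q′) , (λ { zero () ; (suc v) → sub v }) , eq
count-choose {suc n} q k le | false
  with q′ , sub , eq ← count-choose (q ∘ suc) k le =
  (false Vector.∷ q′) , (λ { zero () ; (suc v) → sub v }) , eq

count-witness : ∀ {n} (q : Fin n → Bool) → 0 ℕ.< count q → ∃ λ v → q v ≡ true
count-witness {zero}  q ()
count-witness {suc n} q lt with q zero in q0
... | true  = zero , q0
... | false with v , qv ← count-witness (q ∘ suc) lt = suc v , qv

count-≟ : ∀ {n} (u : Fin n) → count (λ v → does (v ≟ u)) ≡ 1
count-≟ {suc n} zero    = ≡.cong suc (sumℕ-zero n)
count-≟ {suc n} (suc u) = count-≟ u

count-remove : ∀ {n} (q : Fin n → Bool) d → q d ≡ true →
  suc (count (λ v → q v ∧ not (does (v ≟ d)))) ≡ count q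
count-remove q d qd = begin
  1 + count q⁻                                      ≡⟨ ≡.cong (_+ count q⁻) (count-≟ d) ⟨
  count (λ v → does (v ≟ d)) + count q⁻             ≡⟨ sumℕ-distrib-+ (λ v → bit (does (v ≟ d))) _ ⟨
  sumℕ (λ v → bit (does (v ≟ d)) + bit (q⁻ v))      ≡⟨ sumℕ-cong pointwise ⟩
  count q                                           ∎
  where
  open ≡.≡-Reasoning
  open import Data.Nat using (_+_)
  q⁻ : _ → Bool
  q⁻ v = q v ∧ not (does (v ≟ d))
  pointwise : ∀ v → bit (does (v ≟ d)) + bit (q⁻ v) ≡ bit (q v)
  pointwise v with v ≟ d
  ... | yes ≡.refl rewrite qd = ≡.refl
  ... | no _ rewrite Boolₚ.∧-identityʳ (q v) = ≡.refl

-- A multiset of tokens, a token being a vertex reduced to its side and its weight. `⊕` adds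
-- multiplicities and `⊑` is inclusion.
Resource : Set
Resource = Bool → ℕ → ℕ

infixl 6 _⊕_
infixl 7 _⊛_
infix  4 _⊑_

_⊕_ : Resource → Resource → Resource
(C ⊕ D) b j = C b j ℕ.+ D b j

_⊛_ : ℕ → Resource → Resource
(k ⊛ C) b j = k ℕ.* C b j

_⊑_ : Resource → Resource → Set
C ⊑ D = ∀ b j → C b j ℕ.≤ D b j

token : Bool → ℕ → Resource
token b m c j = bit (does (m ℕ.≟ j) ∧ does (b Bool.≟ c))

census : ∀ {n} → (Fin n → Bool) → (Fin n → ℕ) → Resource
census side w b j = sumℕ (λ v → token (side v) (w v) b j)

module _ (M : ℕ) where

  -- The move (b , i) uses an active vertex of weight M - i on side b and a pool of i + 1
  -- vertices of weight i on the other side; i of the latter get weight i + 1, so that the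
  -- total weight of the pool is preserved.
  Input Output : Bool → ℕ → Resource
  Input  b i = suc i ⊛ token (not b) i ⊕ token b (M ∸ i)
  Output b i = i ⊛ token (not b) (suc i)

  -- The total for one cycle of the adversary, which makes `rate i` moves for every pool weight
  -- `i < k` and each of the two sides.
  Inputs Outputs : (ℕ → ℕ) → ℕ → Resource
  Inputs rate zero    _ _ = 0
  Inputs rate (suc k) = Inputs rate k ⊕ (rate k ⊛ Input true k ⊕ rate k ⊛ Input false k)
  Outputs rate zero    _ _ = 0
  Outputs rate (suc k) = Outputs rate k ⊕ (rate k ⊛ Output true k ⊕ rate k ⊛ Output false k)

moves : (ℕ → ℕ) → ℕ → ℕ
moves rate zero    = 0
moves rate (suc k) = moves rate k ℕ.+ (rate k ℕ.+ rate k)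

-- Bookkeeping of weights in a single move.

module ℕ-Rearrange where
  open import Data.Nat using (_+_)
  open Data.Nat.Solver.+-*-Solver

  +-assoc₂ : ∀ a b c d → a + b + c + d ≡ a + (b + (c + d))
  +-assoc₂ = solve 4 (λ a b c d → a :+ b :+ c :+ d := a :+ (b :+ (c :+ d))) ≡.refl

  +-swap : ∀ a b c → a + b + c ≡ a + c + b
  +-swap = solve 3 (λ a b c → a :+ b :+ c := a :+ c :+ b) ≡.refl

  +-reverse : ∀ a b c d → a + b + c + d ≡ a + d + c + b
  +-reverse = solve 4 (λ a b c d → a :+ b :+ c :+ d := a :+ d :+ c :+ b) ≡.refl

  +-rotate : ∀ a b c d → a + (b + (c + d)) ≡ a + c + d + b
  +-rotate = solve 4 (λ a b c d → a :+ (b :+ (c :+ d)) := a :+ c :+ d :+ b) ≡.refl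

  +-twice : ∀ a b c → a + (b + (b + c)) ≡ a + (b + b) + c
  +-twice = solve 3 (λ a b c → a :+ (b :+ (b :+ c)) := a :+ (b :+ b) :+ c) ≡.refl

-- The four ways in which a vertex can take part in a move. The indices record the outcome of the
-- three Boolean tests together with side, old weight and new weight, so that matching on a role
-- turns each pointwise identity into four computations.
data Role (b : Bool) (m i : ℕ) : (isActive isDropped inPool : Bool) (side : Bool) (old new : ℕ) → Set where
  active   : Role b m i true false false b m 0
  dropped  : Role b m i false true true (not b) i 0
  promoted : Role b m i false false true (not b) i (suc i)
  idle     : ∀ {s x} → Role b m i false false false s x x

module Reweighting {n} (side : Fin n → Bool) (w : Fin n → ℕ) (b : Bool) (m i : ℕ)
  (u d : Fin n) (pool : Fin n → Bool)
  (side-u : side u ≡ b) (w-u : w u ≡ m)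
  (side-pool : ∀ v → pool v ≡ true → side v ≡ not b) (w-pool : ∀ v → pool v ≡ true → w v ≡ i)
  (pool-d : pool d ≡ true) (pool-size : count pool ≡ suc i) where

  open import Data.Nat using (_+_; _*_)

  w′ : Fin n → ℕ
  w′ v = if does (v ≟ u) then 0 else if does (v ≟ d) then 0 else if pool v then suc i else w v

  pool-u : pool u ≡ false
  pool-u with pool u in eq
  ... | false = ≡.refl
  ... | true  = ⊥-elim (Boolₚ.not-¬ ≡.refl (≡.trans (≡.sym side-u) (side-pool u eq)))

  d≢u : d ≢ u
  d≢u ≡.refl with () ← ≡.trans (≡.sym pool-d) pool-u

  role : ∀ v → Role b m i (does (v ≟ u)) (does (v ≟ d)) (pool v) (side v) (w v) (w′ v)
  role v with v ≟ u
  ... | yes ≡.refl rewrite dec-false (v ≟ d) (d≢u ∘ ≡.sym) | pool-u | side-u | w-u = active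
  ... | no _ with v ≟ d
  ...   | yes ≡.refl rewrite pool-d | side-pool v pool-d | w-pool v pool-d = dropped
  ...   | no _ with pool v in eq
  ...     | true rewrite side-pool v eq | w-pool v eq = promoted
  ...     | false = idle

  -- The active vertex loses `m`. In the pool every vertex is credited 1, which is `i + 1` in all,
  -- and the dropped vertex is debited `i + 1`, so the pool keeps its total. The terms are moved
  -- across to avoid subtraction.
  total-w′ : sumℕ w′ + m ≡ sumℕ w
  total-w′ = ℕₚ.+-cancelʳ-≡ (suc i) _ _ (begin
    sumℕ w′ + m + suc i
      ≡⟨ ≡.cong₂ (λ x y → sumℕ w′ + x + y) (weigh m u) (weigh (suc i) d) ⟩
    sumℕ w′ + sumℕ (λ v → m * bit (does (v ≟ u))) + sumℕ (λ v → suc i * bit (does (v ≟ d)))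
      ≡⟨ ≡.cong (_+ sumℕ (λ v → suc i * bit (does (v ≟ d)))) (sumℕ-distrib-+ w′ _) ⟨
    sumℕ (λ v → w′ v + m * bit (does (v ≟ u))) + sumℕ (λ v → suc i * bit (does (v ≟ d)))
      ≡⟨ sumℕ-distrib-+ (λ v → w′ v + m * bit (does (v ≟ u))) _ ⟨
    sumℕ (λ v → w′ v + m * bit (does (v ≟ u)) + suc i * bit (does (v ≟ d)))
      ≡⟨ sumℕ-cong pointwise ⟩
    sumℕ (λ v → w v + bit (pool v))
      ≡⟨ sumℕ-distrib-+ w _ ⟩
    sumℕ w + count pool
      ≡⟨ ≡.cong (sumℕ w +_) pool-size ⟩
    sumℕ w + suc i ∎)
    where
    open ≡.≡-Reasoning
    weigh : ∀ k x → k ≡ sumℕ (λ v → k * bit (does (v ≟ x)))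
    weigh k x = ≡.trans (≡.sym (ℕₚ.*-identityʳ k))
      (≡.trans (≡.cong (k *_) (≡.sym (count-≟ x))) (*-distribˡ-sumℕ k (λ v → bit (does (v ≟ x)))))
    pointwise : ∀ v → w′ v + m * bit (does (v ≟ u)) + suc i * bit (does (v ≟ d)) ≡ w v + bit (pool v)
    pointwise v with does (v ≟ u) | does (v ≟ d) | pool v | side v | w v | w′ v | role v
    ... | _ | _ | _ | _ | _ | _ | active
      rewrite ℕₚ.*-identityʳ m | ℕₚ.*-zeroʳ i = ≡.refl
    ... | _ | _ | _ | _ | _ | _ | dropped
      rewrite ℕₚ.*-identityʳ i | ℕₚ.*-zeroʳ m = ℕₚ.+-comm 1 i
    ... | _ | _ | _ | _ | _ | _ | promoted
      rewrite ℕₚ.*-zeroʳ i | ℕₚ.*-zeroʳ m = ≡.trans (ℕₚ.+-identityʳ _) (≡.trans (ℕₚ.+-identityʳ _) (ℕₚ.+-comm 1 i))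
    ... | _ | _ | _ | _ | _ | _ | idle {x = x}
      rewrite ℕₚ.*-zeroʳ i | ℕₚ.*-zeroʳ m = ℕₚ.+-identityʳ (x + 0)

  -- Restricted to `1 ≤ j` because the active and the dropped vertex get weight 0, which adds tokens
  -- of weight 0 that no term accounts for.
  census-balance : ∀ c j → 1 ℕ.≤ j →
    census side w′ c j + (suc i * token (not b) i c j + token b m c j) ≡
    census side w c j + i * token (not b) (suc i) c j
  census-balance c j 1≤j = begin
    census side w′ c j + (suc i * tᵢ + tₘ)
      ≡⟨ ≡.cong (census side w′ c j +_) (≡.cong₂ _+_
           (≡.trans (≡.cong (_* tᵢ) (≡.sym pool-size)) (weigh tᵢ pool))
           (≡.trans (≡.sym (ℕₚ.*-identityˡ tₘ))
             (≡.trans (≡.cong (_* tₘ) (≡.sym (count-≟ u))) (weigh tₘ (λ v → does (v ≟ u)))))) ⟩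
    census side w′ c j + (sumℕ (λ v → tᵢ * bit (pool v)) + sumℕ (λ v → tₘ * bit (does (v ≟ u))))
      ≡⟨ ≡.cong (census side w′ c j +_) (sumℕ-distrib-+ (λ v → tᵢ * bit (pool v)) _) ⟨
    census side w′ c j + sumℕ (λ v → tᵢ * bit (pool v) + tₘ * bit (does (v ≟ u)))
      ≡⟨ sumℕ-distrib-+ (λ v → token (side v) (w′ v) c j) _ ⟨
    sumℕ (λ v → token (side v) (w′ v) c j + (tᵢ * bit (pool v) + tₘ * bit (does (v ≟ u))))
      ≡⟨ sumℕ-cong (pointwise j 1≤j) ⟩
    sumℕ (λ v → token (side v) (w v) c j + tₛ * bit (pool v ∧ not (does (v ≟ d))))
      ≡⟨ sumℕ-distrib-+ (λ v → token (side v) (w v) c j) _ ⟩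
    census side w c j + sumℕ (λ v → tₛ * bit (pool v ∧ not (does (v ≟ d))))
      ≡⟨ ≡.cong (census side w c j +_) (≡.trans (≡.sym (weigh tₛ _))
           (≡.cong (_* tₛ) (ℕₚ.suc-injective (≡.trans (count-remove pool d pool-d) pool-size)))) ⟩
    census side w c j + i * tₛ ∎
    where
    open ≡.≡-Reasoning
    tᵢ = token (not b) i c j
    tₘ = token b m c j
    tₛ = token (not b) (suc i) c j
    weigh : ∀ k (q : Fin n → Bool) → count q * k ≡ sumℕ (λ v → k * bit (q v))
    weigh k q = ≡.trans (ℕₚ.*-comm (count q) k) (*-distribˡ-sumℕ k (λ v → bit (q v)))
    pointwise : ∀ j → 1 ℕ.≤ j → ∀ v →
      token (side v) (w′ v) c j +
        (token (not b) i c j * bit (pool v) + token b m c j * bit (does (v ≟ u))) ≡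
      token (side v) (w v) c j + token (not b) (suc i) c j * bit (pool v ∧ not (does (v ≟ d)))
    pointwise (suc j) _ v with does (v ≟ u) | does (v ≟ d) | pool v | side v | w v | w′ v | role v
    ... | _ | _ | _ | _ | _ | _ | active
      rewrite ℕₚ.*-zeroʳ (token (not b) i c (suc j)) | ℕₚ.*-zeroʳ (token (not b) (suc i) c (suc j))
            | ℕₚ.*-identityʳ (token b m c (suc j)) = ≡.sym (ℕₚ.+-identityʳ _)
    ... | _ | _ | _ | _ | _ | _ | dropped
      rewrite ℕₚ.*-zeroʳ (token b m c (suc j)) | ℕₚ.*-zeroʳ (token (not b) (suc i) c (suc j))
            | ℕₚ.*-identityʳ (token (not b) i c (suc j)) = ≡.refl
    ... | _ | _ | _ | _ | _ | _ | promoted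
      rewrite ℕₚ.*-zeroʳ (token b m c (suc j)) | ℕₚ.*-identityʳ (token (not b) (suc i) c (suc j))
            | ℕₚ.*-identityʳ (token (not b) i c (suc j))
            | ℕₚ.+-identityʳ (token (not b) i c (suc j)) =
      ℕₚ.+-comm (token (not b) (suc i) c (suc j)) _
    ... | _ | _ | _ | _ | _ | _ | idle
      rewrite ℕₚ.*-zeroʳ (token b m c (suc j)) | ℕₚ.*-zeroʳ (token (not b) (suc i) c (suc j))
            | ℕₚ.*-zeroʳ (token (not b) i c (suc j)) = ≡.refl

  -- `C` is a frame: tokens set aside from the move are still there after it, next to those that the
  -- move produces.
  census-step : ∀ (C : Resource) → (∀ c j → 1 ℕ.≤ j →
      C c j + (suc i * token (not b) i c j + token b m c j) ℕ.≤ census side w c j) →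
    ∀ c j → 1 ℕ.≤ j → C c j + i * token (not b) (suc i) c j ℕ.≤ census side w′ c j
  census-step C enough c j 1≤j = ℕₚ.+-cancelʳ-≤ consumed _ _ (begin
    C c j + produced + consumed     ≡⟨ ℕₚ.+-assoc (C c j) produced consumed ⟩
    C c j + (produced + consumed)   ≡⟨ ≡.cong (C c j +_) (ℕₚ.+-comm produced consumed) ⟩
    C c j + (consumed + produced)   ≡⟨ ℕₚ.+-assoc (C c j) consumed produced ⟨
    C c j + consumed + produced     ≤⟨ ℕₚ.+-monoˡ-≤ produced (enough c j 1≤j) ⟩
    census side w c j + produced    ≡⟨ census-balance c j 1≤j ⟨
    census side w′ c j + consumed   ∎)
    where
    open ℕₚ.≤-Reasoning
    produced = i * token (not b) (suc i) c j
    consumed = suc i * token (not b) i c j + token b m c j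

-- Layouts of an instance and their adaptive extension.

transpose-left : ∀ {n} (i j : Fin n) → transpose i j i ≡ j
transpose-left i j rewrite dec-true (i ≟ i) ≡.refl = ≡.refl

transpose-right : ∀ {n} (i j : Fin n) → transpose i j j ≡ i
transpose-right i j with j ≟ i
... | yes j≡i = j≡i
... | no _ rewrite dec-true (j ≟ j) ≡.refl = ≡.refl

transpose-other : ∀ {n} (i j : Fin n) {k} → k ≢ i → k ≢ j → transpose i j k ≡ k
transpose-other i j {k} k≢i k≢j rewrite dec-false (k ≟ i) k≢i | dec-false (k ≟ j) k≢j = ≡.refl

≢true⇒≡false : ∀ {b} → (b ≡ true → ⊥) → b ≡ false
≢true⇒≡false {true}  ¬b = ⊥-elim (¬b ≡.refl)
≢true⇒≡false {false} _  = ≡.refl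

T⇒≡true : ∀ {b} → T b → b ≡ true
T⇒≡true {true} _ = ≡.refl

≡false⇒¬T : ∀ {b} → b ≡ false → ¬ T b
≡false⇒¬T ≡.refl ()

-- All vertices arrive before any deadline, in the order of their names; σ t is
-- the vertex whose deadline comes t-th.
record Layout {n : ℕ} (side : Fin n → Bool) : Set where
  field
    σ         : Permutation′ n
    graph     : Graph n
  open Graph graph public
  field
    bipartite : ∀ u v → Edge u v → side u ≢ side v

  turn : Fin n → ℕ
  turn v = toℕ (σ ⟨$⟩ˡ v)

module _ {n : ℕ} {side : Fin n → Bool} where

  open Layout

  -- What an algorithm blind to hidden edges can know after `t` deadlines: their order, and all
  -- edges at their vertices. Edges between the remaining vertices are left open.
  record AgreeBelow (t : ℕ) (D D′ : Layout side) : Set where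
    field
      same-order : ∀ j → toℕ j ℕ.< t → σ D′ ⟨$⟩ʳ j ≡ σ D ⟨$⟩ʳ j
      same-edges : ∀ j → toℕ j ℕ.< t → ∀ v → adj D′ (σ D ⟨$⟩ʳ j) v ≡ adj D (σ D ⟨$⟩ʳ j) v

  module Extension (D : Layout side) (t : ℕ) (u : Fin n) (t≤u : t ℕ.≤ turn D u)
    (pool : Fin n → Bool)
    (pool-side : ∀ v → pool v ≡ true → side v ≡ not (side u))
    (pool-late : ∀ v → pool v ≡ true → t ℕ.≤ turn D v) where

    pool-u : pool u ≡ false
    pool-u = ≢true⇒≡false λ p → Boolₚ.not-¬ ≡.refl (pool-side u p)

    t<n : t ℕ.< n
    t<n = ℕₚ.≤-<-trans t≤u (toℕ<n _)

    now next : Fin n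
    now  = fromℕ< t<n
    next = σ D ⟨$⟩ˡ u

    toℕ-now : toℕ now ≡ t
    toℕ-now = toℕ-fromℕ< t<n

    extended-adj : Fin n → Fin n → Bool
    extended-adj x y = adj D x y ∨ (does (x ≟ u) ∧ pool y ∨ does (y ≟ u) ∧ pool x)

    extended-loopless : ∀ x → extended-adj x x ≡ false
    extended-loopless x rewrite loopless D x with x ≟ u
    ... | no  _      = ≡.refl
    ... | yes ≡.refl rewrite pool-u = ≡.refl

    extended-bipartite : ∀ x y → T (extended-adj x y) → side x ≢ side y
    extended-bipartite x y e with adj D x y in a
    ... | true = bipartite D x y (≡.subst T (≡.sym a) tt)
    ... | false with x ≟ u | y ≟ u
    ...   | yes ≡.refl | yes ≡.refl rewrite pool-u = ⊥-elim e
    ...   | yes ≡.refl | no _ with pool y in p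
    ...     | true  = λ eq → Boolₚ.not-¬ (≡.sym eq) (pool-side y p)
    ...     | false = ⊥-elim e
    extended-bipartite x y e | false | no _ | yes ≡.refl =
      λ eq → Boolₚ.not-¬ eq (pool-side x (T⇒≡true e))
    extended-bipartite x y e | false | no _ | no _ = ⊥-elim e

    extended : Layout side
    extended = record
      -- Exchanging two turns makes the deadline of `u` the next one. Both turns are at least `t`,
      -- so the past is unchanged.
      { σ     = Perm.transpose now next ∘ₚ σ D
      ; graph = record
        { adj       = extended-adj
        ; symmetric = λ x y → ≡.cong₂ _∨_ (symmetric D x y) (Boolₚ.∨-comm (does (x ≟ u) ∧ pool y) _)
        ; loopless  = extended-loopless }
      ; bipartite = extended-bipartite }

    early≢u : ∀ {v} → turn D v ℕ.< t → v ≢ u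
    early≢u lt ≡.refl = ℕₚ.<⇒≱ lt t≤u

    early∉pool : ∀ {v} → turn D v ℕ.< t → pool v ≡ false
    early∉pool lt = ≢true⇒≡false λ p → ℕₚ.<⇒≱ lt (pool-late _ p)

    turn-σ : ∀ j → turn D (σ D ⟨$⟩ʳ j) ≡ toℕ j
    turn-σ j = ≡.cong toℕ (inverseˡ (σ D))

    -- Every new edge joins `u` to the pool, and neither contains a vertex processed before turn
    -- `t`.
    extended-agrees : AgreeBelow t D extended
    extended-agrees = record { same-order = order ; same-edges = edges }
      where
      order : ∀ j → toℕ j ℕ.< t → σ extended ⟨$⟩ʳ j ≡ σ D ⟨$⟩ʳ j
      order j j<t = ≡.cong (σ D ⟨$⟩ʳ_) (transpose-other now next
        (λ { ≡.refl → ℕₚ.<-irrefl toℕ-now j<t }) (λ { ≡.refl → ℕₚ.<⇒≱ j<t t≤u }))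
      edges : ∀ j → toℕ j ℕ.< t → ∀ v →
        extended-adj (σ D ⟨$⟩ʳ j) v ≡ adj D (σ D ⟨$⟩ʳ j) v
      edges j j<t v
        with early ← ≡.subst (ℕ._< t) (≡.sym (turn-σ j)) j<t
        rewrite dec-false ((σ D ⟨$⟩ʳ j) ≟ u) (early≢u early) | early∉pool early
              | Boolₚ.∧-zeroʳ (does (v ≟ u)) = Boolₚ.∨-identityʳ _

    extended-turn-u : turn extended u ≡ t
    extended-turn-u = ≡.trans (≡.cong toℕ (transpose-left next now)) toℕ-now

    -- The vertex displaced from turn `t` takes over the old turn of `u`, which is then larger than
    -- `t`.
    extended-turn-late : ∀ v → t ℕ.≤ turn D v → v ≢ u → suc t ℕ.≤ turn extended v
    extended-turn-late v t≤v v≢u with (σ D ⟨$⟩ˡ v) ≟ now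
    ... | yes eq rewrite eq | transpose-right next now = ℕₚ.≤∧≢⇒< t≤u λ t≡ →
      v≢u (≡.trans (≡.sym (inverseʳ (σ D))) (≡.trans (≡.cong (σ D ⟨$⟩ʳ_)
        (≡.trans eq (toℕ-injective (≡.trans toℕ-now t≡)))) (inverseʳ (σ D))))
    ... | no neq rewrite transpose-other next now
      (λ eq → v≢u (≡.trans (≡.sym (inverseʳ (σ D))) (≡.trans (≡.cong (σ D ⟨$⟩ʳ_) eq) (inverseʳ (σ D))))) neq =
      ℕₚ.≤∧≢⇒< t≤v λ t≡ → neq (toℕ-injective (≡.trans (≡.sym t≡) (≡.sym toℕ-now)))

    extended-turn-early : ∀ v → turn D v ℕ.< t → turn extended v ≡ turn D v
    extended-turn-early v v<t = ≡.cong toℕ (transpose-other next now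
      (λ eq → ℕₚ.<⇒≱ v<t (≡.subst (λ x → t ℕ.≤ toℕ x) (≡.sym eq) t≤u))
      (λ eq → ℕₚ.<-irrefl (≡.trans (≡.cong toℕ eq) toℕ-now) v<t))

-- Minimisers and cardinalities in the ordered field.

module Counting {c ℓ₁ ℓ₂} (R : RealField c ℓ₁ ℓ₂) where

  open RealField R hiding (zero)
  open OrderedField R

  -- The order of the reals is not decidable, so each comparison uses excluded middle under a double
  -- negation. This is enough because the final goal is a negation.
  ¬¬-argmin : ∀ {n} (q : Fin n → Bool) (f : Fin n → ℝ) → (∃ λ v → q v ≡ true) →
    ¬ ¬ (∃ λ d → q d ≡ true × ∀ v → q v ≡ true → f d ≤ᵣ f v)
  ¬¬-argmin {suc n} q f witness k = ¬¬-excluded-middle {A = ∃ λ v → q (suc v) ≡ true} λ where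
      (no none)  → first-only witness none
      (yes some) → ¬¬-argmin (q ∘ suc) (f ∘ suc) some (with-rest some)
    where
    first-only : (∃ λ v → q v ≡ true) → ¬ (∃ λ v → q (suc v) ≡ true) → ⊥
    first-only (suc v , qv) none = none (v , qv)
    first-only (zero , q0)  none = k (zero , q0 , λ { zero _ → ≤-refl ; (suc v) qv → ⊥-elim (none (v , qv)) })
    with-rest : (∃ λ v → q (suc v) ≡ true) →
      ¬ (∃ λ d → q (suc d) ≡ true × ∀ v → q (suc v) ≡ true → f (suc d) ≤ᵣ f (suc v))
    with-rest some (d , qd , min) = ¬¬-excluded-middle {A = q zero ≡ true × f zero <ᵣ f (suc d)} λ where
      (yes (q0 , lt)) → k (zero , q0 , λ
        { zero _ → ≤-refl ; (suc v) qv → ≤-trans (<⇒≤ lt) (min v qv) })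
      (no ¬lt) → k (suc d , qd , λ { zero q0 lt → ¬lt (q0 , lt) ; (suc v) → min v })

  sum-guard-const : ∀ {n} (q : Fin n → Bool) x → sum (λ v → guard (q v) x) ≈ ι (count q) * x
  sum-guard-const {zero}  q x = sym (zeroˡ x)
  sum-guard-const {suc n} q x with q zero
  ... | true  = trans (+-congˡ (sum-guard-const (q ∘ suc) x)) (sym (ι-suc-* (count (q ∘ suc)) x))
  ... | false = trans (+-identityˡ _) (sum-guard-const (q ∘ suc) x)

  ι-sumℕ : ∀ {n} (f : Fin n → ℕ) → ι (sumℕ f) ≈ sum (λ v → ι (f v))
  ι-sumℕ {zero}  f = refl
  ι-sumℕ {suc n} f = trans (ι-+ (f zero) _) (+-congˡ (ι-sumℕ (f ∘ suc)))

∧-true : ∀ {a b} → a ∧ b ≡ true → a ≡ true × b ≡ true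
∧-true {true} {true} _ = ≡.refl , ≡.refl

does-true : ∀ {p} {P : Set p} (P? : Dec P) → does P? ≡ true → P
does-true (yes p) _ = p

does-false : ∀ {p} {P : Set p} (P? : Dec P) → does P? ≡ false → ¬ P
does-false (no ¬p) _ = ¬p

token-self : ∀ b m → token b m b m ≡ 1
token-self b m rewrite dec-true (m ℕ.≟ m) ≡.refl | dec-true (b Bool.≟ b) ≡.refl = ≡.refl

token-true : ∀ {x y b j} → does (y ℕ.≟ j) ∧ does (x Bool.≟ b) ≡ true → x ≡ b × y ≡ j
token-true {x} {y} {b} {j} eq with p , q ← ∧-true eq =
  does-true (x Bool.≟ b) q , does-true (y ℕ.≟ j) p

count-below : ∀ n t → count {n} (λ j → does (toℕ j ℕ.<? t)) ℕ.≤ t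
count-below zero    t       = z≤n
count-below (suc n) zero    = ℕₚ.≤-reflexive (sumℕ-zero n)
count-below (suc n) (suc t) = s≤s (count-below n t)

-- The token game against a response `Y` that depends only on the past.

module Game {c ℓ₁ ℓ₂} (R : RealField c ℓ₁ ℓ₂) {n : ℕ} (side : Fin n → Bool) (M W₀ : ℕ)
  (Y : Layout side → Fin n → Fin n → RealField.ℝ R)
  (Y-matching : ∀ D → FullyOnline.IsFractionalMatching R (Layout.graph D) (Y D))
  (Y-local : ∀ t D D′ → AgreeBelow t D D′ → ∀ j → toℕ j ℕ.< t →
             ∀ v → RealField._≈_ R (Y D′ (Layout.σ D ⟨$⟩ʳ j) v) (Y D (Layout.σ D ⟨$⟩ʳ j) v))
  where

  open FullyOnline R
  open OrderedField R
  open RealField R hiding (zero)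
  open Matrices R {n}
  open Counting R
  open Layout

  -- The inequality potential is stated with terms moved across, so that no subtraction
  -- occurs; Z matches every processed vertex with the pool vertex dropped in its move.
  record State (t : ℕ) (stock : Resource) : Set (c ⊔ ℓ₁ ⊔ ℓ₂) where
    field
      layout     : Layout side
      weight     : Fin n → ℕ
      late       : ∀ v → weight v ≢ 0 → t ℕ.≤ turn layout v
      covered    : ∀ x y → t ℕ.≤ turn layout x → t ℕ.≤ turn layout y → adj layout x y ≡ false
      potential  : ι M * value (Y layout) + ι (sumℕ weight) ≤ᵣ
                   ι W₀ + sum (λ v → ι (weight v) * row (Y layout) v)
      Z          : Matrix
      Z-matching : IsFractionalMatching (graph layout) Z
      Z-value    : value Z ≈ ι t
      Z-free     : ∀ v → weight v ≢ 0 → row Z v ≈ 0#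
      in-stock   : ∀ b j → 1 ℕ.≤ j → stock b j ℕ.≤ census side weight b j

  open ℕ-Rearrange

  module Move {t stock} (S : State t stock) (b : Bool) (m i : ℕ) (M≡m+i : M ≡ m ℕ.+ i)
    (1≤m : 1 ℕ.≤ m) (1≤i : 1 ℕ.≤ i)
    (u : Fin n) (side-u : side u ≡ b) (weight-u : State.weight S u ≡ m)
    (pool : Fin n → Bool)
    (side-pool : ∀ v → pool v ≡ true → side v ≡ not b)
    (weight-pool : ∀ v → pool v ≡ true → State.weight S v ≡ i)
    (pool-size : count pool ≡ suc i)
    where

    open State S renaming (layout to D)

    nonzero : ∀ {x y} → 1 ℕ.≤ y → x ≡ y → x ≢ 0
    nonzero (s≤s _) ≡.refl ()

    late-u : t ℕ.≤ turn D u
    late-u = late u (nonzero 1≤m weight-u)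

    late-pool : ∀ v → pool v ≡ true → t ℕ.≤ turn D v
    late-pool v p = late v (nonzero 1≤i (weight-pool v p))

    open Extension D t u late-u pool (λ v p → ≡.trans (side-pool v p) (≡.cong not (≡.sym side-u))) late-pool

    open IsFractionalMatching (Y-matching extended) using ()
      renaming (symm to Y′-symm; support to Y′-support; capacity to Y′-capacity)
    open IsFractionalMatching (Y-matching D) using ()
      renaming (symm to Y-symm; support to Y-support)

    Y₀ Y′ : Matrix
    Y₀ = Y D
    Y′ = Y extended

    -- Only the new edges count: `u` may already carry value on edges to processed vertices whose
    -- pools contained it.
    gain : Fin n → ℝ
    gain v = guard (pool v) (Y′ u v)

    gain-u : gain u ≈ 0#
    gain-u rewrite pool-u = refl

    Y′-early : ∀ x y → turn D x ℕ.< t → Y′ x y ≈ Y₀ x y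
    Y′-early x y lt = ≡.subst (λ x → Y′ x y ≈ Y₀ x y) (inverseʳ (σ D))
      (Y-local t D extended extended-agrees (σ D ⟨$⟩ˡ x) lt y)

    Y′-nonedge : ∀ x y → extended-adj x y ≡ false → Y′ x y ≈ 0#
    Y′-nonedge x y eq = Y′-support x y (≡false⇒¬T eq)

    star-early : ∀ x y → turn D x ℕ.< t → star u gain x y ≈ 0#
    star-early x y lt rewrite dec-false (x ≟ u) (early≢u lt) | early∉pool lt =
      trans (+-identityˡ _) (guard-0 (does (y ≟ u)))

    star-sym : ∀ e x y → star u e x y ≈ star u e y x
    star-sym e x y = +-comm _ _

    star-late : ∀ x y → t ℕ.≤ turn D x → t ℕ.≤ turn D y → Y′ x y ≈ star u gain x y
    star-late x y t≤x t≤y with nonedge ← Y′-nonedge x y rewrite covered x y t≤x t≤y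
      with x ≟ u | y ≟ u
    ... | yes ≡.refl | yes ≡.refl rewrite pool-u = trans (nonedge ≡.refl) (sym (+-identityʳ 0#))
    ... | no _ | no _ = trans (nonedge ≡.refl) (sym (+-identityʳ 0#))
    ... | yes ≡.refl | no _ with pool y
    ...   | true  = sym (+-identityʳ _)
    ...   | false = trans (nonedge ≡.refl) (sym (+-identityʳ 0#))
    star-late x y t≤x t≤y | no _ | yes ≡.refl with pool x
    ...   | true  = trans (Y′-symm x u) (sym (+-identityˡ _))
    ...   | false = trans (nonedge ≡.refl) (sym (+-identityʳ 0#))

    -- Rows of processed vertices are frozen by `Y-local`, and by symmetry so are their columns.
    -- Between two unprocessed vertices there was no edge before, and the only edges there now are
    -- those from `u` to the pool.
    Y′-star : ∀ x y → Y′ x y ≈ Y₀ x y + star u gain x y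
    Y′-star x y with turn D x ℕ.<? t | turn D y ℕ.<? t
    ... | yes x<t | _ = trans (Y′-early x y x<t)
      (sym (trans (+-congˡ (star-early x y x<t)) (+-identityʳ _)))
    ... | no _ | yes y<t = trans (trans (Y′-symm x y) (trans (Y′-early y x y<t) (Y-symm y x)))
      (sym (trans (+-congˡ (trans (star-sym gain x y) (star-early y x y<t))) (+-identityʳ _)))
    ... | no x≮t | no y≮t = trans (star-late x y t≤x t≤y)
      (sym (trans (+-congʳ (Y-support x y (≡false⇒¬T (covered x y t≤x t≤y)))) (+-identityˡ _)))
      where
      t≤x = ℕₚ.≮⇒≥ x≮t
      t≤y = ℕₚ.≮⇒≥ y≮t

    mass : ℝ
    mass = sum gain

    value-Y′ : value Y′ ≈ value Y₀ + mass
    value-Y′ = trans (value-cong Y′-star)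
      (trans (value-+ Y₀ (star u gain)) (+-congˡ (value-star u gain gain-u)))

    row-Y′ : ∀ x → row Y′ x ≈ row Y₀ x + (guard (does (x ≟ u)) mass + gain x)
    row-Y′ x = trans (sum-cong-≋ (Y′-star x))
      (trans (∑-distrib-+ (Y₀ x) (star u gain x)) (+-congˡ (row-star u gain x)))

    module Drop (d : Fin n) (pool-d : pool d ≡ true)
      (minimal : ∀ v → pool v ≡ true → row Y′ d ≤ᵣ row Y′ v) where

      open Reweighting side weight b m i u d pool side-u weight-u side-pool weight-pool pool-d pool-size
        hiding (pool-u) public

      open Solver using (_:+_; _:*_; con; solve; _:=_)
      open ≤-Reasoning

      -- The contribution of one vertex to `sum-role-potential`, with `r` and `r′` its matched
      -- amounts before and after the move. The capacity bound `r′ ≤ᵣ 1#` is used for the active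
      -- vertex; all other roles give equalities. A pool vertex turns `i * r′ + r′` into
      -- `(i + 1) * r′`, which is its new weighted amount if promoted and the last term on the right
      -- if dropped.
      role-potential : ∀ {isActive isDropped inPool s x y} → Role b m i isActive isDropped inPool s x y →
        ∀ {r r′} e → r′ ≈ r + (guard isActive mass + guard inPool e) → r′ ≤ᵣ 1# →
        ι x * r + (guard inPool (ι i * guard inPool e) + guard isActive (ι m * mass)) + guard inPool r′ ≤ᵣ
        ι y * r′ + guard isActive (ι m) + guard isDropped (ι (suc i) * r′)
      role-potential active {r} {r′} e eq le = begin
        ι m * r + (0# + ι m * mass) + 0#
          ≈⟨ solve 3 (λ k r x → k :* r :+ (con 0 :+ k :* x) :+ con 0 := k :* (r :+ (x :+ con 0)))
               refl (ι m) r mass ⟩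
        ι m * (r + (mass + 0#))        ≈⟨ *-congˡ eq ⟨
        ι m * r′                       ≤⟨ ι-*-mono m le ⟩
        ι m * 1#
          ≈⟨ solve 2 (λ k r → k :* con 1 := con 0 :* r :+ k :+ con 0) refl (ι m) r′ ⟩
        0# * r′ + ι m + 0#             ∎
      role-potential dropped {r} {r′} e eq le = begin
        ι i * r + (ι i * e + 0#) + r′
          ≈⟨ solve 4 (λ k r e r′ → k :* r :+ (k :* e :+ con 0) :+ r′ := k :* (r :+ (con 0 :+ e)) :+ r′)
               refl (ι i) r e r′ ⟩
        ι i * (r + (0# + e)) + r′      ≈⟨ +-congʳ (*-congˡ eq) ⟨
        ι i * r′ + r′
          ≈⟨ solve 2 (λ k r → k :* r :+ r := con 0 :* r :+ con 0 :+ (con 1 :+ k) :* r) refl (ι i) r′ ⟩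
        0# * r′ + 0# + ι (suc i) * r′  ∎
      role-potential promoted {r} {r′} e eq le = begin
        ι i * r + (ι i * e + 0#) + r′
          ≈⟨ solve 4 (λ k r e r′ → k :* r :+ (k :* e :+ con 0) :+ r′ := k :* (r :+ (con 0 :+ e)) :+ r′)
               refl (ι i) r e r′ ⟩
        ι i * (r + (0# + e)) + r′      ≈⟨ +-congʳ (*-congˡ eq) ⟨
        ι i * r′ + r′
          ≈⟨ solve 2 (λ k r → k :* r :+ r := (con 1 :+ k) :* r :+ con 0 :+ con 0) refl (ι i) r′ ⟩
        ι (suc i) * r′ + 0# + 0#       ∎
      role-potential (idle {x = x}) {r} {r′} e eq le = begin
        ι x * r + (0# + 0#) + 0#
          ≈⟨ solve 2 (λ k r → k :* r :+ (con 0 :+ con 0) :+ con 0 := k :* (r :+ (con 0 :+ con 0)) :+ con 0 :+ con 0)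
               refl (ι x) r ⟩
        ι x * (r + (0# + 0#)) + 0# + 0#  ≈⟨ +-congʳ (+-congʳ (*-congˡ eq)) ⟨
        ι x * r′ + 0# + 0#               ∎

      ΣwY₀ Σw′Y′ : ℝ
      ΣwY₀  = sum (λ v → ι (weight v) * row Y₀ v)
      Σw′Y′ = sum (λ v → ι (w′ v) * row Y′ v)

      sum-role-potential : ΣwY₀ + (ι i * mass + ι m * mass) + sum (λ v → guard (pool v) (row Y′ v)) ≤ᵣ
        Σw′Y′ + ι m + ι (suc i) * row Y′ d
      sum-role-potential = begin
        ΣwY₀ + (ι i * mass + ι m * mass) + sum pooled
          ≈⟨ +-congʳ (+-congˡ (+-cong
               (trans (*-distribˡ-sum (ι i) gain) (sum-cong-≋ λ v → sym (idem v)))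
               (sym (sum-guard-≟ u (λ _ → ι m * mass))))) ⟩
        ΣwY₀ + (sum passive + sum activated) + sum pooled
          ≈⟨ +-congʳ (+-congˡ (∑-distrib-+ passive activated)) ⟨
        ΣwY₀ + sum (λ v → passive v + activated v) + sum pooled
          ≈⟨ +-congʳ (∑-distrib-+ (λ v → ι (weight v) * row Y₀ v) _) ⟨
        sum (λ v → ι (weight v) * row Y₀ v + (passive v + activated v)) + sum pooled
          ≈⟨ ∑-distrib-+ (λ v → ι (weight v) * row Y₀ v + (passive v + activated v)) _ ⟨
        sum (λ v → ι (weight v) * row Y₀ v + (passive v + activated v) + pooled v)
          ≤⟨ sum-mono (λ v → role-potential (role v) (Y′ u v) (row-Y′ v) (Y′-capacity v)) ⟩
        sum (λ v → ι (w′ v) * row Y′ v + guard (does (v ≟ u)) (ι m) +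
                   guard (does (v ≟ d)) (ι (suc i) * row Y′ v))
          ≈⟨ ∑-distrib-+ (λ v → ι (w′ v) * row Y′ v + guard (does (v ≟ u)) (ι m)) _ ⟩
        sum (λ v → ι (w′ v) * row Y′ v + guard (does (v ≟ u)) (ι m)) +
          sum (λ v → guard (does (v ≟ d)) (ι (suc i) * row Y′ v))
          ≈⟨ +-cong (∑-distrib-+ (λ v → ι (w′ v) * row Y′ v) _) (sum-guard-≟ d _) ⟩
        Σw′Y′ + sum (λ v → guard (does (v ≟ u)) (ι m)) + ι (suc i) * row Y′ d
          ≈⟨ +-congʳ (+-congˡ (sum-guard-≟ u (λ _ → ι m))) ⟩
        Σw′Y′ + ι m + ι (suc i) * row Y′ d ∎
        where
        pooled passive activated : Fin n → ℝ
        pooled v    = guard (pool v) (row Y′ v)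
        passive v   = guard (pool v) (ι i * gain v)
        activated v = guard (does (v ≟ u)) (ι m * mass)
        idem : ∀ v → passive v ≈ ι i * gain v
        idem v with pool v
        ... | true  = refl
        ... | false = sym (zeroʳ (ι i))

      dropped-below-average : ι (suc i) * row Y′ d ≤ᵣ sum (λ v → guard (pool v) (row Y′ v))
      dropped-below-average = begin
        ι (suc i) * row Y′ d                  ≈⟨ *-congʳ (ι-cong pool-size) ⟨
        ι (count pool) * row Y′ d             ≈⟨ sum-guard-const pool (row Y′ d) ⟨
        sum (λ v → guard (pool v) (row Y′ d)) ≤⟨ sum-mono min ⟩
        sum (λ v → guard (pool v) (row Y′ v)) ∎
        where
        min : ∀ v → guard (pool v) (row Y′ d) ≤ᵣ guard (pool v) (row Y′ v)
        min v with pool v in p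
        ... | true  = minimal v p
        ... | false = ≤-refl

      ι-M : ι M ≈ ι m + ι i
      ι-M = trans (ι-cong M≡m+i) (ι-+ m i)

      -- Since `M = m + i`, each unit on a new edge is paid for by `m` at `u` and `i` at its pool
      -- endpoint. The term of the dropped vertex is at most the sum over the pool, because its row
      -- is minimal among `i + 1` rows; that sum then cancels.
      weight-payoff : ΣwY₀ + ι M * mass ≤ᵣ Σw′Y′ + ι m
      weight-payoff = +-cancelʳ-≤ (sum (λ v → guard (pool v) (row Y′ v))) (begin
        ΣwY₀ + ι M * mass + pooled
          ≈⟨ +-congʳ (+-congˡ (trans (*-congʳ ι-M)
               (trans (distribʳ mass (ι m) (ι i)) (+-comm _ _)))) ⟩
        ΣwY₀ + (ι i * mass + ι m * mass) + pooled ≤⟨ sum-role-potential ⟩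
        Σw′Y′ + ι m + ι (suc i) * row Y′ d        ≤⟨ +-monoʳ-≤ _ dropped-below-average ⟩
        Σw′Y′ + ι m + pooled                      ∎)
        where pooled = sum (λ v → guard (pool v) (row Y′ v))

      -- The value grows by `mass` while the total weight falls by `m`, and `weight-payoff` trades
      -- exactly these two amounts.
      potential′ : ι M * value Y′ + ι (sumℕ w′) ≤ᵣ ι W₀ + Σw′Y′
      potential′ = +-cancelʳ-≤ (ι m) (begin
        ι M * value Y′ + ι (sumℕ w′) + ι m
          ≈⟨ trans (+-assoc _ _ _) (+-cong (*-congˡ value-Y′)
               (trans (sym (ι-+ (sumℕ w′) m)) (ι-cong total-w′))) ⟩
        ι M * (value Y₀ + mass) + ι (sumℕ weight)
          ≈⟨ solve 4 (λ k v x w → k :* (v :+ x) :+ w := k :* v :+ w :+ k :* x) refl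
               (ι M) (value Y₀) mass (ι (sumℕ weight)) ⟩
        ι M * value Y₀ + ι (sumℕ weight) + ι M * mass
          ≤⟨ +-monoˡ-≤ _ potential ⟩
        ι W₀ + ΣwY₀ + ι M * mass
          ≈⟨ +-assoc _ _ _ ⟩
        ι W₀ + (ΣwY₀ + ι M * mass)
          ≤⟨ +-monoʳ-≤ _ weight-payoff ⟩
        ι W₀ + (Σw′Y′ + ι m)
          ≈⟨ +-assoc _ _ _ ⟨
        ι W₀ + Σw′Y′ + ι m ∎)

      w′-alive : ∀ v → w′ v ≢ 0 → v ≢ u × v ≢ d × weight v ≢ 0
      w′-alive v with v ≟ u | v ≟ d | pool v in p
      ... | yes _ | _     | _     = λ ≢0 → ⊥-elim (≢0 ≡.refl)
      ... | no _  | yes _ | _     = λ ≢0 → ⊥-elim (≢0 ≡.refl)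
      ... | no v≢u | no v≢d | true  = λ _ → v≢u , v≢d , nonzero 1≤i (weight-pool v p)
      ... | no v≢u | no v≢d | false = λ ≢0 → v≢u , v≢d , ≢0

      late′ : ∀ v → w′ v ≢ 0 → suc t ℕ.≤ turn extended v
      late′ v ≢0 with v≢u , _ , alive ← w′-alive v ≢0 = extended-turn-late v (late v alive) v≢u

      later : ∀ {x} → suc t ℕ.≤ turn extended x → x ≢ u
      later t<x ≡.refl = ℕₚ.<-irrefl (≡.sym extended-turn-u) t<x

      before : ∀ x → suc t ℕ.≤ turn extended x → t ℕ.≤ turn D x
      before x t<x = ℕₚ.≮⇒≥ λ x<t →
        ℕₚ.<-asym x<t (≡.subst (t ℕ.<_) (extended-turn-early x x<t) t<x)

      -- Every new edge contains `u`, which has now been processed.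
      covered′ : ∀ x y → suc t ℕ.≤ turn extended x → suc t ℕ.≤ turn extended y →
        extended-adj x y ≡ false
      covered′ x y t<x t<y
        rewrite dec-false (x ≟ u) (later t<x) | dec-false (y ≟ u) (later t<y)
              | covered x y (before x t<x) (before y t<y) = ≡.refl

      matched : Fin n → ℝ
      matched v = guard (does (v ≟ d)) 1#

      sum-matched : sum matched ≈ 1#
      sum-matched = sum-guard-≟ d (λ _ → 1#)

      Z′ : Matrix
      Z′ x y = Z x y + star u matched x y

      open IsFractionalMatching Z-matching

      row-Z′ : ∀ x → row Z′ x ≈ row Z x + (guard (does (x ≟ u)) 1# + matched x)
      row-Z′ x = trans (∑-distrib-+ (Z x) (star u matched x))
        (+-congˡ (trans (row-star u matched x) (+-congʳ (guard-cong (does (x ≟ u)) sum-matched))))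

      0≤1 : 0# ≤ᵣ 1#
      0≤1 = <⇒≤ 0<1

      Z′-value : value Z′ ≈ ι (suc t)
      Z′-value = trans (value-+ Z (star u matched)) (trans (+-comm _ _)
        (+-cong (trans (value-star u matched matched-u) sum-matched) Z-value))
        where
        matched-u : matched u ≈ 0#
        matched-u rewrite dec-false (u ≟ d) (d≢u ∘ ≡.sym) = refl

      Z′-free : ∀ v → w′ v ≢ 0 → row Z′ v ≈ 0#
      Z′-free v ≢0 with v≢u , v≢d , alive ← w′-alive v ≢0 = trans (row-Z′ v) zeros
        where
        zeros : row Z v + (guard (does (v ≟ u)) 1# + matched v) ≈ 0#
        zeros rewrite dec-false (v ≟ u) v≢u | dec-false (v ≟ d) v≢d =
          trans (+-cong (Z-free v alive) (+-identityʳ 0#)) (+-identityʳ 0#)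

      star-matched-support : ∀ x y → ¬ T (extended-adj x y) → star u matched x y ≈ 0#
      star-matched-support x y ¬e with adj D x y
      ... | true = ⊥-elim (¬e tt)
      ... | false with x ≟ u | y ≟ u | x ≟ d | y ≟ d
      ...   | yes ≡.refl | _ | yes ≡.refl | _ = ⊥-elim (d≢u ≡.refl)
      ...   | yes _ | no _ | no _ | no _ = +-identityʳ 0#
      ...   | yes _ | yes _ | no _ | no _ = +-identityʳ 0#
      ...   | yes _ | _ | no _ | yes ≡.refl rewrite pool-d = ⊥-elim (¬e tt)
      ...   | no _ | no _ | _ | _ = +-identityʳ 0#
      ...   | no _ | yes _ | no _ | _ = +-identityʳ 0#
      ...   | no _ | yes _ | yes ≡.refl | _ rewrite pool-d = ⊥-elim (¬e tt)

      -- Both `u` and `d` had nonzero weight before the move, so `Z-free` leaves room for one full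
      -- unit on the pool edge between them.
      Z′-matching : IsFractionalMatching (graph extended) Z′
      Z′-matching = record
        { symm     = λ x y → +-cong (symm x y) (star-sym matched x y)
        ; support  = λ x y ¬e → trans
            (+-cong (support x y (¬e ∘ old-edge x y)) (star-matched-support x y ¬e)) (+-identityʳ 0#)
        ; nonneg   = λ x y → ≤-trans (nonneg x y) (x≤x+y (≤-trans
            (guard-nonneg (does (x ≟ u)) (guard-nonneg (does (y ≟ d)) 0≤1))
            (x≤x+y (guard-nonneg (does (y ≟ u)) (guard-nonneg (does (x ≟ d)) 0≤1)))))
        ; capacity = λ x → ≤-trans (≤-reflexive (row-Z′ x)) (cap x) }
        where
        old-edge : ∀ x y → T (adj D x y) → T (extended-adj x y)
        old-edge x y e rewrite T⇒≡true e = tt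
        cap : ∀ x → row Z x + (guard (does (x ≟ u)) 1# + matched x) ≤ᵣ 1#
        cap x with x ≟ u | x ≟ d
        ... | yes ≡.refl | yes ≡.refl = ⊥-elim (d≢u ≡.refl)
        ... | yes ≡.refl | no _ = ≤-reflexive (trans
          (+-cong (Z-free x (nonzero 1≤m weight-u)) (+-identityʳ 1#)) (+-identityˡ 1#))
        ... | no _ | yes ≡.refl = ≤-reflexive (trans
          (+-cong (Z-free x (nonzero 1≤i (weight-pool x pool-d))) (+-identityˡ 1#)) (+-identityˡ 1#))
        ... | no _ | no _ = ≤-trans
          (≤-reflexive (trans (+-congˡ (+-identityʳ 0#)) (+-identityʳ _))) (capacity x)

      next-state : ∀ {stock′} →
        (∀ c j → 1 ℕ.≤ j → stock′ c j ℕ.≤ census side w′ c j) → State (suc t) stock′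
      next-state in-stock′ = record
        { layout = extended ; weight = w′ ; late = late′ ; covered = covered′
        ; potential = potential′ ; Z = Z′ ; Z-matching = Z′-matching ; Z-value = Z′-value
        ; Z-free = Z′-free ; in-stock = in-stock′ }

  weaken : ∀ {t C D} → D ⊑ C → State t C → State t D
  weaken D⊑C S = record
    { layout = layout ; weight = weight ; late = late ; covered = covered
    ; potential = potential ; Z = Z ; Z-matching = Z-matching ; Z-value = Z-value
    ; Z-free = Z-free ; in-stock = λ b j 1≤j → ℕₚ.≤-trans (D⊑C b j) (in-stock b j 1≤j) }
    where open State S

  retime : ∀ {t t′ C} → t ≡ t′ → State t C → State t′ C
  retime ≡.refl S = S

  -- Doubly negated because the dropped vertex comes from `¬¬-argmin`; moves are therefore chained
  -- by continuations.
  Reachable : ℕ → Resource → Set (c ⊔ ℓ₁ ⊔ ℓ₂)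
  Reachable t C = ¬ ¬ State t C

  move : ∀ {t C} b i → 1 ℕ.≤ i → i ℕ.< M →
    State t (C ⊕ Input M b i) → Reachable (suc t) (C ⊕ Output M b i)
  move {t} {C} b i 1≤i i<M S k =
    ¬¬-argmin pool (row Y′) (count-witness pool (≡.subst (0 ℕ.<_) (≡.sym pool-size) (s≤s z≤n)))
      λ { (d , pool-d , minimal) →
        let open Drop d pool-d minimal
        in k (next-state (census-step C in-stock)) }
    where
    open State S
    m = M ∸ i
    1≤m : 1 ℕ.≤ m
    1≤m = ℕₚ.m<n⇒0<n∸m i<M

    -- The same Boolean as in `token`, so `count (holds b j)` is the census by definition and
    -- `in-stock` bounds it directly.
    holds : Bool → ℕ → Fin n → Bool
    holds b j v = does (weight v ℕ.≟ j) ∧ does (side v Bool.≟ b)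

    enough-active : 1 ℕ.≤ count (holds b m)
    enough-active = ℕₚ.≤-trans (ℕₚ.≤-trans (ℕₚ.≤-reflexive (≡.sym (token-self b m)))
      (ℕₚ.≤-trans (ℕₚ.m≤n+m _ (suc i ℕ.* token (not b) i b m)) (ℕₚ.m≤n+m _ (C b m))))
      (in-stock b m 1≤m)

    enough-pool : suc i ℕ.≤ count (holds (not b) i)
    enough-pool = ℕₚ.≤-trans (ℕₚ.≤-trans
      (ℕₚ.≤-reflexive (≡.sym (≡.trans (≡.cong (suc i ℕ.*_) (token-self (not b) i)) (ℕₚ.*-identityʳ (suc i)))))
      (ℕₚ.≤-trans (ℕₚ.m≤m+n _ (token b m (not b) i)) (ℕₚ.m≤n+m _ (C (not b) i))))
      (in-stock (not b) i 1≤i)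

    u = proj₁ (count-witness (holds b m) enough-active)
    u-holds = token-true {side u} (proj₂ (count-witness (holds b m) enough-active))

    chosen = count-choose (holds (not b) i) (suc i) enough-pool
    pool = proj₁ chosen
    pool-size = proj₂ (proj₂ chosen)
    pool-holds : ∀ v → pool v ≡ true → side v ≡ not b × weight v ≡ i
    pool-holds v p = token-true {side v} (proj₁ (proj₂ chosen) v p)

    open Move S b m i (≡.sym (ℕₚ.m∸n+n≡m (ℕₚ.<⇒≤ i<M))) 1≤m 1≤i u (proj₁ u-holds) (proj₂ u-holds)
      pool (λ v p → proj₁ (pool-holds v p)) (λ v p → proj₂ (pool-holds v p)) pool-size

  -- Inputs of the remaining moves and outputs of the finished ones travel in the frame. The range
  -- of `i` is demanded only for `x ≢ 0`, as rates vanish outside that range.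
  fire : ∀ {t C} b i x → (x ≢ 0 → 1 ℕ.≤ i × i ℕ.< M) →
    State t (C ⊕ x ⊛ Input M b i) → Reachable (x ℕ.+ t) (C ⊕ x ⊛ Output M b i)
  fire b i zero ok S k = k S
  fire {t} {C} b i (suc x) ok S k with 1≤i , i<M ← ok (λ ()) =
    move {C = C ⊕ x ⊛ Input M b i} b i 1≤i i<M
      (weaken (λ c j → ℕₚ.≤-reflexive (≡.trans (ℕₚ.+-assoc (C c j) _ _)
        (≡.cong (C c j ℕ.+_) (ℕₚ.+-comm _ (Input M b i c j))))) S)
      λ S₁ → fire {suc t} {C ⊕ Output M b i} b i x (λ _ → 1≤i , i<M)
        (weaken (λ c j → ℕₚ.≤-reflexive (+-swap (C c j) (Output M b i c j) _)) S₁)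
        λ S₂ → k (retime (ℕₚ.+-suc x t)
          (weaken (λ c j → ℕₚ.≤-reflexive (≡.sym (ℕₚ.+-assoc (C c j) _ _))) S₂))

  module Cycles (rate : ℕ → ℕ) (rate-ok : ∀ i → rate i ≢ 0 → 1 ℕ.≤ i × i ℕ.< M)
    (fresh : Resource) (balanced : Inputs M rate M ⊑ Outputs M rate M ⊕ fresh) where

    -- All inputs are in stock at the start, so the moves can be made in any order; here pool
    -- weights descend.
    phase : ∀ {t C} k → State t (C ⊕ Inputs M rate k) →
      Reachable (moves rate k ℕ.+ t) (C ⊕ Outputs M rate k)
    phase zero S κ = κ S
    phase {t} {C} (suc k) S κ =
      fire {C = C ⊕ Inputs M rate k ⊕ rate k ⊛ Input M true k} false k (rate k) (rate-ok k)
        (weaken (λ c j → ℕₚ.≤-reflexive (+-assoc₂ (C c j) _ _ _)) S)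
      λ S₁ → fire {C = C ⊕ Inputs M rate k ⊕ rate k ⊛ Output M false k} true k (rate k) (rate-ok k)
        (weaken (λ c j → ℕₚ.≤-reflexive (+-swap (C c j ℕ.+ Inputs M rate k c j) _ _)) S₁)
      λ S₂ → phase {C = C ⊕ rate k ⊛ Output M true k ⊕ rate k ⊛ Output M false k} k
        (weaken (λ c j → ℕₚ.≤-reflexive (+-reverse (C c j) _ _ _)) S₂)
      λ S₃ → κ (retime (+-twice (moves rate k) (rate k) t)
        (weaken (λ c j → ℕₚ.≤-reflexive (+-rotate (C c j) _ _ _)) S₃))

    -- `Outputs M rate M` is the permanent stock: by `balanced`, it covers the inputs of a cycle
    -- together with one batch of `fresh`, and the cycle restores it.
    cycles : ∀ {t} K → State t (Outputs M rate M ⊕ K ⊛ fresh) →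
      Reachable (K ℕ.* moves rate M ℕ.+ t) (Outputs M rate M)
    cycles zero S κ = κ (weaken (λ c j → ℕₚ.m≤m+n _ 0) S)
    cycles {t} (suc K) S κ = phase {C = K ⊛ fresh} M (weaken resupply S)
      λ S₁ → cycles K (weaken (λ c j → ℕₚ.≤-reflexive (ℕₚ.+-comm (Outputs M rate M c j) _)) S₁)
      λ S₂ → κ (retime count-cycles S₂)
      where
      resupply : K ⊛ fresh ⊕ Inputs M rate M ⊑ Outputs M rate M ⊕ suc K ⊛ fresh
      resupply c j = ℕₚ.≤-trans (ℕₚ.+-monoʳ-≤ (K ℕ.* fresh c j) (balanced c j))
        (ℕₚ.≤-reflexive (≡.trans (ℕₚ.+-comm (K ℕ.* fresh c j) _)
          (ℕₚ.+-assoc (Outputs M rate M c j) _ _)))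
      count-cycles : K ℕ.* moves rate M ℕ.+ (moves rate M ℕ.+ t) ≡ suc K ℕ.* moves rate M ℕ.+ t
      count-cycles = ≡.trans (≡.sym (ℕₚ.+-assoc (K ℕ.* moves rate M) _ t))
        (≡.cong (ℕ._+ t) (ℕₚ.+-comm (K ℕ.* moves rate M) _))

  empty-layout : Layout side
  empty-layout = record
    { σ         = Perm.id
    ; graph     = record { adj = λ _ _ → false ; symmetric = λ _ _ → ≡.refl ; loopless = λ _ → ≡.refl }
    ; bipartite = λ _ _ () }

  value-zero : ∀ {x : Matrix} → (∀ u v → x u v ≈ 0#) → value x ≈ 0#
  value-zero x≈0 = sum-zero λ u → sum-zero λ v →
    trans (guard-cong (does (u <? v)) (x≈0 u v)) (guard-0 (does (u <? v)))

  initial-state : ∀ {stock} (w : Fin n → ℕ) → sumℕ w ≡ W₀ → stock ⊑ census side w → State 0 stock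
  initial-state w total-w in-stock = record
    { layout = empty-layout ; weight = w
    ; late = λ _ _ → z≤n ; covered = λ _ _ _ _ → ≡.refl
    ; potential = begin
        ι M * value (Y empty-layout) + ι (sumℕ w)
          ≈⟨ +-cong (trans (*-congˡ (value-zero Y≈0)) (zeroʳ _)) (ι-cong total-w) ⟩
        0# + ι W₀  ≈⟨ +-comm 0# (ι W₀) ⟩
        ι W₀ + 0#
          ≈⟨ +-congˡ (sum-zero {n} λ v → trans (*-congˡ (sum-zero (Y≈0 v))) (zeroʳ (ι (w v)))) ⟨
        ι W₀ + sum (λ v → ι (w v) * row (Y empty-layout) v) ∎
    ; Z = λ _ _ → 0#
    ; Z-matching = record
        { symm = λ _ _ → refl ; support = λ _ _ _ → refl ; nonneg = λ _ _ → ≤-refl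
        ; capacity = λ _ → ≤-trans (≤-reflexive (sum-zero {n} λ _ → refl)) (<⇒≤ 0<1) }
    ; Z-value = value-zero λ _ _ → refl
    ; Z-free = λ _ _ → sum-zero {n} λ _ → refl
    ; in-stock = λ b j _ → in-stock b j }
    where
    open ≤-Reasoning
    Y≈0 : ∀ u v → Y empty-layout u v ≈ 0#
    Y≈0 u v = IsFractionalMatching.support (Y-matching empty-layout) u v λ ()

  -- By capacity the weighted sum of rows is at most the total weight, which then cancels from
  -- `potential`.
  value-bound : ∀ {t C} (S : State t C) → ι M * value (Y (State.layout S)) ≤ᵣ ι W₀
  value-bound S = +-cancelʳ-≤ (ι (sumℕ weight)) (begin
    ι M * value (Y layout) + ι (sumℕ weight)
      ≤⟨ potential ⟩
    ι W₀ + sum (λ v → ι (weight v) * row (Y layout) v)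
      ≤⟨ +-monoʳ-≤ _ (sum-mono λ v →
           ι-*-mono (weight v) (IsFractionalMatching.capacity (Y-matching layout) v)) ⟩
    ι W₀ + sum (λ v → ι (weight v) * 1#)
      ≈⟨ +-congˡ (trans (sum-cong-≋ λ v → *-identityʳ (ι (weight v))) (sym (ι-sumℕ weight))) ⟩
    ι W₀ + ι (sumℕ weight) ∎)
    where
    open State S
    open ≤-Reasoning

  -- `Z` attains `t`. For the upper bound, `covered` says that the processed vertices form a vertex
  -- cover, and there are at most `t` of them.
  optimum : ∀ {t C} (S : State t C) → IsOPT (graph (State.layout S)) (ι t)
  optimum {t} S = (Z , Z-matching , Z-value) , λ x x-matching →
    let open IsFractionalMatching x-matching in begin
    value x
      ≤⟨ value-≤-cover x past symm nonneg (λ u v u-late v-late → support u v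
           (≡false⇒¬T (covered u v (not-past u u-late) (not-past v v-late)))) ⟩
    sum (λ v → guard (past v) (row x v))
      ≤⟨ sum-mono (λ v → guard-mono (past v) (capacity v)) ⟩
    sum (λ v → guard (past v) 1#)
      ≈⟨ trans (sum-guard-const past 1#) (*-identityʳ _) ⟩
    ι (count past)
      ≤⟨ ι-mono few-past ⟩
    ι t ∎
    where
    open State S
    open ≤-Reasoning
    past : Fin n → Bool
    past v = does (turn layout v ℕ.<? t)
    not-past : ∀ v → past v ≡ false → t ℕ.≤ turn layout v
    not-past v eq = ℕₚ.≮⇒≥ (does-false (turn layout v ℕ.<? t) eq)
    few-past : count past ℕ.≤ t
    few-past = ℕₚ.≤-trans
      (ℕₚ.≤-reflexive (≡.sym (sumℕ-permute (λ j → bit (does (toℕ j ℕ.<? t))) (Perm.flip (σ layout)))))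
      (count-below n t)

-- Sums over initial segments and closed forms for the tokens of a cycle.

module RangeSums where
  open import Data.Nat using (_+_; _*_; _≤_; _<_)
  open Data.Nat.Solver.+-*-Solver

  Σ< : ℕ → (ℕ → ℕ) → ℕ
  Σ< zero    f = 0
  Σ< (suc k) f = Σ< k f + f k

  Σ<-cong : ∀ k {f g} → (∀ i → i < k → f i ≡ g i) → Σ< k f ≡ Σ< k g
  Σ<-cong zero    eq = ≡.refl
  Σ<-cong (suc k) eq = ≡.cong₂ _+_ (Σ<-cong k λ i i<k → eq i (ℕₚ.m<n⇒m<1+n i<k)) (eq k ℕₚ.≤-refl)

  Σ<-mono : ∀ k {f g} → (∀ i → i < k → f i ≤ g i) → Σ< k f ≤ Σ< k g
  Σ<-mono zero    le = z≤n
  Σ<-mono (suc k) le = ℕₚ.+-mono-≤ (Σ<-mono k λ i i<k → le i (ℕₚ.m<n⇒m<1+n i<k)) (le k ℕₚ.≤-refl)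

  Σ<-+ : ∀ k f g → Σ< k (λ i → f i + g i) ≡ Σ< k f + Σ< k g
  Σ<-+ zero    f g = ≡.refl
  Σ<-+ (suc k) f g = ≡.trans (≡.cong (_+ (f k + g k)) (Σ<-+ k f g))
    (solve 4 (λ a b c d → a :+ b :+ (c :+ d) := a :+ c :+ (b :+ d)) ≡.refl (Σ< k f) (Σ< k g) (f k) (g k))

  Σ<-head : ∀ k f → Σ< (suc k) f ≡ f 0 + Σ< k (f ∘ suc)
  Σ<-head zero    f = ℕₚ.+-comm 0 (f 0)
  Σ<-head (suc k) f = ≡.trans (≡.cong (_+ f (suc k)) (Σ<-head k f)) (ℕₚ.+-assoc (f 0) _ _)

  Σ<-reverse : ∀ k f → Σ< (suc k) (λ i → f (k ∸ i)) ≡ Σ< (suc k) f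
  Σ<-reverse zero    f = ≡.refl
  Σ<-reverse (suc k) f = begin
    Σ< (suc k) (λ i → f (suc k ∸ i)) + f (k ∸ k)
      ≡⟨ ≡.cong₂ _+_ (Σ<-cong (suc k) λ i i<1+k → ≡.cong f (ℕₚ.+-∸-assoc 1 (ℕₚ.≤-pred i<1+k)))
                     (≡.cong f (ℕₚ.n∸n≡0 k)) ⟩
    Σ< (suc k) (λ i → f (suc (k ∸ i))) + f 0  ≡⟨ ≡.cong (_+ f 0) (Σ<-reverse k (f ∘ suc)) ⟩
    Σ< (suc k) (f ∘ suc) + f 0                ≡⟨ ℕₚ.+-comm _ (f 0) ⟩
    f 0 + Σ< (suc k) (f ∘ suc)                ≡⟨ Σ<-head (suc k) f ⟨
    Σ< (suc (suc k)) f ∎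
    where open ≡.≡-Reasoning

  at : (ℕ → ℕ) → ℕ → ℕ → ℕ
  at f j i = f i * bit (does (i ℕ.≟ j))

  Σ<-at-zero : ∀ k f j → k ≤ j → Σ< k (at f j) ≡ 0
  Σ<-at-zero zero    f j k≤j = ≡.refl
  Σ<-at-zero (suc k) f j k<j rewrite Σ<-at-zero k f j (ℕₚ.<⇒≤ k<j) | dec-false (k ℕ.≟ j) (ℕₚ.<⇒≢ k<j) =
    ℕₚ.*-zeroʳ (f k)

  Σ<-at : ∀ k f j → j < k → Σ< k (at f j) ≡ f j
  Σ<-at (suc k) f j j<1+k with k ℕ.≟ j
  ... | yes ≡.refl rewrite Σ<-at-zero k f k ℕₚ.≤-refl | dec-true (k ℕ.≟ k) ≡.refl = ℕₚ.*-identityʳ (f k)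
  ... | no k≢j rewrite dec-false (k ℕ.≟ j) k≢j | ℕₚ.*-zeroʳ (f k) =
    ≡.trans (ℕₚ.+-identityʳ _) (Σ<-at k f j (ℕₚ.≤∧≢⇒< (ℕₚ.≤-pred j<1+k) (k≢j ∘ ≡.sym)))

  Σ<-at-≤ : ∀ k f j → Σ< k (at f j) ≤ f j
  Σ<-at-≤ k f j with j ℕ.<? k
  ... | yes j<k = ℕₚ.≤-reflexive (Σ<-at k f j j<k)
  ... | no  j≮k = ℕₚ.≤-trans (ℕₚ.≤-reflexive (Σ<-at-zero k f j (ℕₚ.≮⇒≥ j≮k))) z≤n

  bit-∧ : ∀ b → bit (b ∧ true) + bit (b ∧ false) ≡ bit b
  bit-∧ true  = ≡.refl
  bit-∧ false = ≡.refl

  token-both : ∀ m c j → token true m c j + token false m c j ≡ bit (does (m ℕ.≟ j))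
  token-both m true  j = bit-∧ (does (m ℕ.≟ j))
  token-both m false j = ≡.trans (ℕₚ.+-comm _ (bit (does (m ℕ.≟ j) ∧ true))) (bit-∧ (does (m ℕ.≟ j)))

  module _ (M : ℕ) (rate : ℕ → ℕ) where

    Inputs-≡ : ∀ k c j → Inputs M rate k c j ≡
      Σ< k (λ i → rate i * suc i * bit (does (i ℕ.≟ j)) + rate i * bit (does ((M ∸ i) ℕ.≟ j)))
    Inputs-≡ zero    c j = ≡.refl
    Inputs-≡ (suc k) c j = ≡.cong₂ _+_ (Inputs-≡ k c j) (≡.trans
      (solve 6 (λ ρ i a b x y → ρ :* (i :* b :+ x) :+ ρ :* (i :* a :+ y) := ρ :* i :* (a :+ b) :+ ρ :* (x :+ y)) ≡.refl
        (rate k) (suc k) (token true k c j) (token false k c j) (token true (M ∸ k) c j) (token false (M ∸ k) c j))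
      (≡.cong₂ (λ x y → rate k * suc k * x + rate k * y) (token-both k c j) (token-both (M ∸ k) c j)))

    Outputs-≡ : ∀ k c j → Outputs M rate k c j ≡ Σ< k (λ i → rate i * i * bit (does (suc i ℕ.≟ j)))
    Outputs-≡ zero    c j = ≡.refl
    Outputs-≡ (suc k) c j = ≡.cong₂ _+_ (Outputs-≡ k c j) (≡.trans
      (solve 4 (λ ρ i a b → ρ :* (i :* b) :+ ρ :* (i :* a) := ρ :* i :* (a :+ b)) ≡.refl
        (rate k) k (token true (suc k) c j) (token false (suc k) c j))
      (≡.cong (rate k * k *_) (token-both (suc k) c j)))

    -- Weight `j` is consumed in two ways: by pools, `j + 1` tokens for each move of pool weight
    -- `j`, and as the active token of moves of pool weight `M ∸ j`.
    Inputs-≤ : ∀ c j → Inputs M rate M c j ≤ rate j * suc j + rate (M ∸ j)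
    Inputs-≤ c j = begin
      Inputs M rate M c j
        ≡⟨ Inputs-≡ M c j ⟩
      Σ< M (λ i → rate i * suc i * bit (does (i ℕ.≟ j)) + rate i * bit (does ((M ∸ i) ℕ.≟ j)))
        ≤⟨ Σ<-mono M (λ i i<M → ℕₚ.+-monoʳ-≤ (rate i * suc i * bit (does (i ℕ.≟ j)))
             (ℕₚ.*-monoʳ-≤ (rate i) (reflect i i<M))) ⟩
      Σ< M (λ i → at (λ i → rate i * suc i) j i + at rate (M ∸ j) i)
        ≡⟨ Σ<-+ M (at (λ i → rate i * suc i) j) (at rate (M ∸ j)) ⟩
      Σ< M (at (λ i → rate i * suc i) j) + Σ< M (at rate (M ∸ j))
        ≤⟨ ℕₚ.+-mono-≤ (Σ<-at-≤ M (λ i → rate i * suc i) j) (Σ<-at-≤ M rate (M ∸ j)) ⟩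
      rate j * suc j + rate (M ∸ j) ∎
      where
      open ℕₚ.≤-Reasoning
      reflect : ∀ i → i < M → bit (does ((M ∸ i) ℕ.≟ j)) ≤ bit (does (i ℕ.≟ M ∸ j))
      reflect i i<M with (M ∸ i) ℕ.≟ j
      ... | no ≢ rewrite dec-false ((M ∸ i) ℕ.≟ j) ≢ = z≤n
      ... | yes ≡.refl rewrite dec-true ((M ∸ i) ℕ.≟ (M ∸ i)) ≡.refl | dec-true (i ℕ.≟ M ∸ (M ∸ i)) (≡.sym (ℕₚ.m∸[m∸n]≡n (ℕₚ.<⇒≤ i<M))) = ℕₚ.≤-refl

    Outputs-≥ : ∀ c j → j ≤ M → rate (j ∸ 1) * (j ∸ 1) ≤ Outputs M rate M c j
    -- At `j = 0` the truncated `j ∸ 1` is `0`, so the left side vanishes.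
    Outputs-≥ c zero    _   = ℕₚ.≤-trans (ℕₚ.≤-reflexive (ℕₚ.*-zeroʳ (rate 0))) z≤n
    Outputs-≥ c (suc j) j<M = ℕₚ.≤-reflexive (≡.sym (≡.trans (Outputs-≡ M c (suc j))
      (≡.trans (Σ<-cong M λ i _ → ≡.cong (λ b → rate i * i * bit b) (does-suc i))
        (Σ<-at M (λ i → rate i * i) j j<M))))
      where
      does-suc : ∀ i → does (suc i ℕ.≟ suc j) ≡ does (i ℕ.≟ j)
      does-suc i = ≡.refl

    moves-≡ : ∀ k → moves rate k ≡ Σ< k rate + Σ< k rate
    moves-≡ zero    = ≡.refl
    moves-≡ (suc k) = ≡.trans (≡.cong (_+ (rate k + rate k)) (moves-≡ k))
      (solve 2 (λ a b → a :+ a :+ (b :+ b) := a :+ b :+ (a :+ b)) ≡.refl (Σ< k rate) (rate k))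

-- Stationary rates of the moves.

module Rates (r s : ℕ) (1≤r : 1 ℕ.≤ r) (r<s : r ℕ.< s)
  (triangular : (r ℕ.+ s) ℕ.* suc (r ℕ.+ s) ≡ 2 ℕ.* (s ℕ.* suc s)) where

  open import Data.Nat using (_+_; _*_; _≤_; _<_; _≤?_)
  open RangeSums

  M : ℕ
  M = r + s

  -- The reciprocal of `k` scaled by `M !`, exact for `1 ≤ k ≤ M`; the value at 0 is a default.
  quot : ℕ → ℕ
  quot zero    = 0
  quot (suc k) = M ! ℕ./ suc k

  quot-* : ∀ k → 1 ≤ k → k ≤ M → k * quot k ≡ M !
  quot-* (suc k) _ k<M = m*[n/m]≡n (∣-trans (m∣m*n (k !)) (m≤n⇒m!∣n! k<M))

  excess : ℕ → ℕ
  excess i = s * suc s ∸ i * suc i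

  -- (s (s + 1) - i (i + 1)) / (i (i + 1) (M - i)), scaled by (M !)³: by triangular this solves
  -- rate-recurrence, and it vanishes at i = s, so that no vertex ever gets weight s + 1.
  rate : ℕ → ℕ
  rate i = if does (r ≤? i) then quot i * quot (suc i) * quot (M ∸ i) * excess i else 0

  rate-low : ∀ {i} → i < r → rate i ≡ 0
  rate-low {i} i<r rewrite dec-false (r ≤? i) (ℕₚ.<⇒≱ i<r) = ≡.refl

  rate-mid : ∀ {i} → r ≤ i → rate i ≡ quot i * quot (suc i) * quot (M ∸ i) * excess i
  rate-mid {i} r≤i rewrite dec-true (r ≤? i) r≤i = ≡.refl

  -- From `s` on the subtraction in `excess` gives 0.
  rate-high : ∀ {i} → s ≤ i → rate i ≡ 0
  rate-high {i} s≤i = ≡.trans (rate-mid (ℕₚ.≤-trans (ℕₚ.<⇒≤ r<s) s≤i))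
    (≡.trans (≡.cong (quot i * quot (suc i) * quot (M ∸ i) *_)
      (ℕₚ.m≤n⇒m∸n≡0 (ℕₚ.*-mono-≤ s≤i (s≤s s≤i))))
      (ℕₚ.*-zeroʳ (quot i * quot (suc i) * quot (M ∸ i))))

  s≤M : s ≤ M
  s≤M = ℕₚ.m≤n+m s r

  rate-ok : ∀ i → rate i ≢ 0 → 1 ≤ i × i < M
  rate-ok i ≢0 = ℕₚ.≤-trans 1≤r (ℕₚ.≮⇒≥ (≢0 ∘ rate-low)) ,
    ℕₚ.<-≤-trans (ℕₚ.≰⇒> (≢0 ∘ rate-high)) s≤M

  -- Fresh tokens of weight `r` per side and cycle. No move produces weight `r`, since
  -- `rate (r ∸ 1)` is 0; active tokens of weight `r` would belong to pool weight `s`, whose rate is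
  -- 0. What remains is `r + 1` pool tokens for each of `rate r` moves.
  supply : ℕ
  supply = suc r * rate r

  -- The difference `excess i - excess (i + 1)` is `2 (i + 1)`. By `triangular`, with `M` written as
  -- `(i + 1) + p`, the sum `excess (i + 1) + excess p` is the cross term `2 p (i + 1)`. The bounds
  -- by `s` keep the truncated subtractions exact.
  excess-identity : ∀ i p → i + p + 1 ≡ M → suc i ≤ s → p ≤ s →
    suc p * excess (suc i) + excess p ≡ p * excess i
  excess-identity i p eq i<s p≤s = begin
    suc p * y + z         ≡⟨ solve 3 (λ p y z → (con 1 :+ p) :* y :+ z := p :* y :+ (y :+ z)) ≡.refl p y z ⟩
    p * y + (y + z)       ≡⟨ ≡.cong (p * y +_) y+z ⟩
    p * y + 2 * (p * suc i) ≡⟨ solve 3 (λ p y i → p :* y :+ con 2 :* (p :* (con 1 :+ i)) := p :* (y :+ con 2 :* (con 1 :+ i))) ≡.refl p y i ⟩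
    p * (y + 2 * suc i)   ≡⟨ ≡.cong (p *_) x≡ ⟨
    p * x                 ∎
    where
    open ≡.≡-Reasoning
    open Data.Nat.Solver.+-*-Solver
    q x y z : ℕ
    q = s * suc s
    x = excess i
    y = excess (suc i)
    z = excess p
    fill : ∀ j → j ≤ s → excess j + j * suc j ≡ q
    fill j j≤s = ℕₚ.m∸n+n≡m (ℕₚ.*-mono-≤ j≤s (s≤s j≤s))
    x≡ : x ≡ y + 2 * suc i
    x≡ = ℕₚ.+-cancelʳ-≡ (i * suc i) x _ (≡.trans (fill i (ℕₚ.<⇒≤ i<s)) (≡.trans (≡.sym (fill (suc i) i<s))
      (solve 2 (λ y i → y :+ (con 1 :+ i) :* (con 2 :+ i) := y :+ con 2 :* (con 1 :+ i) :+ i :* (con 1 :+ i)) ≡.refl y i)))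
    y+z : y + z ≡ 2 * (p * suc i)
    y+z = ℕₚ.+-cancelʳ-≡ (suc i * suc (suc i) + p * suc p) _ _ (begin
      y + z + (suc i * suc (suc i) + p * suc p)
        ≡⟨ solve 4 (λ a b c d → a :+ b :+ (c :+ d) := a :+ c :+ (b :+ d)) ≡.refl y z (suc i * suc (suc i)) (p * suc p) ⟩
      y + suc i * suc (suc i) + (z + p * suc p)  ≡⟨ ≡.cong₂ _+_ (fill (suc i) i<s) (fill p p≤s) ⟩
      q + q                                      ≡⟨ solve 1 (λ q → q :+ q := con 2 :* q) ≡.refl q ⟩
      2 * q                                      ≡⟨ triangular ⟨
      M * suc M                                  ≡⟨ ≡.cong (λ m → m * suc m) eq ⟨
      (i + p + 1) * suc (i + p + 1)
        ≡⟨ solve 2 (λ i p → (i :+ p :+ con 1) :* (con 1 :+ (i :+ p :+ con 1)) :=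
                     con 2 :* (p :* (con 1 :+ i)) :+ ((con 1 :+ i) :* (con 2 :+ i) :+ p :* (con 1 :+ p))) ≡.refl i p ⟩
      2 * (p * suc i) + (suc i * suc (suc i) + p * suc p) ∎)

  -- Weight `i + 1` is consumed as fast as it is produced. Products `k * quot k` all equal `M !`, so
  -- `i + 2` can be traded for `p + 1` and `p` for `i`; after taking out the common factors,
  -- `excess-identity` remains.
  rate-recurrence : ∀ i → r ≤ i → suc i ≤ s →
    rate (suc i) * suc (suc i) + rate (M ∸ suc i) ≡ rate i * i
  rate-recurrence i r≤i i<s = begin
    rate (suc i) * suc (suc i) + rate p
      ≡⟨ ≡.cong₂ (λ a b → a * suc (suc i) + b) (rate-mid (ℕₚ.m≤n⇒m≤1+n r≤i)) (rate-mid r≤p) ⟩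
    Qi₁ * Qi₂ * Qp * y * suc (suc i) + Qp * Qp₁ * quot (M ∸ p) * z
      ≡⟨ ≡.cong (λ k → Qi₁ * Qi₂ * Qp * y * suc (suc i) + Qp * Qp₁ * quot k * z) M∸p ⟩
    Qi₁ * Qi₂ * Qp * y * suc (suc i) + Qp * Qp₁ * Qi₁ * z
      ≡⟨ solve 7 (λ a b c y k d z → a :* b :* c :* y :* k :+ c :* d :* a :* z :=
                   a :* c :* y :* (k :* b) :+ c :* d :* a :* z) ≡.refl Qi₁ Qi₂ Qp y (suc (suc i)) Qp₁ z ⟩
    Qi₁ * Qp * y * (suc (suc i) * Qi₂) + Qp * Qp₁ * Qi₁ * z
      ≡⟨ ≡.cong (λ F → Qi₁ * Qp * y * F + Qp * Qp₁ * Qi₁ * z)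
           (≡.trans (quot-* (suc (suc i)) (s≤s z≤n) 2+i≤M) (≡.sym (quot-* (suc p) (s≤s z≤n) p<M))) ⟩
    Qi₁ * Qp * y * (suc p * Qp₁) + Qp * Qp₁ * Qi₁ * z
      ≡⟨ solve 6 (λ a c y k d z → a :* c :* y :* (k :* d) :+ c :* d :* a :* z :=
                   a :* c :* d :* (k :* y :+ z)) ≡.refl Qi₁ Qp y (suc p) Qp₁ z ⟩
    Qi₁ * Qp * Qp₁ * (suc p * y + z)
      ≡⟨ ≡.cong (Qi₁ * Qp * Qp₁ *_) (excess-identity i p i+p+1≡M i<s p≤s) ⟩
    Qi₁ * Qp * Qp₁ * (p * x)
      ≡⟨ solve 5 (λ a c d p x → a :* c :* d :* (p :* x) := p :* c :* a :* d :* x) ≡.refl Qi₁ Qp Qp₁ p x ⟩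
    p * Qp * Qi₁ * Qp₁ * x
      ≡⟨ ≡.cong (λ F → F * Qi₁ * Qp₁ * x)
           (≡.trans (quot-* p (ℕₚ.≤-trans 1≤r r≤p) (ℕₚ.<⇒≤ p<M)) (≡.sym (quot-* i (ℕₚ.≤-trans 1≤r r≤i) (ℕₚ.≤-trans (ℕₚ.<⇒≤ i<s) s≤M)))) ⟩
    i * quot i * Qi₁ * Qp₁ * x
      ≡⟨ solve 5 (λ i a b d x → i :* a :* b :* d :* x := a :* b :* d :* x :* i) ≡.refl i (quot i) Qi₁ Qp₁ x ⟩
    quot i * Qi₁ * Qp₁ * x * i
      ≡⟨ ≡.cong (λ k → quot i * Qi₁ * quot k * x * i) M∸i ⟨
    quot i * Qi₁ * quot (M ∸ i) * x * i
      ≡⟨ ≡.cong (_* i) (rate-mid r≤i) ⟨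
    rate i * i ∎
    where
    open ≡.≡-Reasoning
    open Data.Nat.Solver.+-*-Solver
    p x y z Qi₁ Qi₂ Qp Qp₁ : ℕ
    p = M ∸ suc i
    x = excess i
    y = excess (suc i)
    z = excess p
    Qi₁ = quot (suc i)
    Qi₂ = quot (suc (suc i))
    Qp  = quot p
    Qp₁ = quot (suc p)
    1+i≤M : suc i ≤ M
    1+i≤M = ℕₚ.≤-trans i<s s≤M
    p+1+i≡M : p + suc i ≡ M
    p+1+i≡M = ℕₚ.m∸n+n≡m 1+i≤M
    i+p+1≡M : i + p + 1 ≡ M
    i+p+1≡M = ≡.trans (solve 2 (λ i p → i :+ p :+ con 1 := p :+ (con 1 :+ i)) ≡.refl i p) p+1+i≡M
    M∸p : M ∸ p ≡ suc i
    M∸p = ℕₚ.m∸[m∸n]≡n 1+i≤M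
    M∸i : M ∸ i ≡ suc p
    M∸i = ℕₚ.+-cancelʳ-≡ i _ _ (≡.trans (ℕₚ.m∸n+n≡m (ℕₚ.<⇒≤ 1+i≤M)) (≡.trans (≡.sym p+1+i≡M) (ℕₚ.+-suc p i)))
    r≤p : r ≤ p
    r≤p = ℕₚ.m+n≤o⇒m≤o∸n r (ℕₚ.+-monoʳ-≤ r i<s)
    p<M : suc p ≤ M
    p<M = ℕₚ.≤-trans (ℕₚ.m≤m+n (suc p) i) (ℕₚ.≤-reflexive (≡.trans (≡.sym (ℕₚ.+-suc p i)) p+1+i≡M))
    p≤s : p ≤ s
    p≤s = ℕₚ.m≤n+o⇒m∸n≤o M (suc i) (ℕₚ.+-monoˡ-≤ s (ℕₚ.m≤n⇒m≤1+n r≤i))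
    2+i≤M : suc (suc i) ≤ M
    2+i≤M = ℕₚ.+-mono-≤ 1≤r i<s

  -- Below `r` and above `s` all rates in the equation vanish, at `r` the fresh supply makes up the
  -- difference, and from `r + 1` to `s` this is `rate-recurrence`.
  balance : ∀ j → j ≤ M →
    rate j * suc j + rate (M ∸ j) ≡ rate (j ∸ 1) * (j ∸ 1) + supply * bit (does (r ℕ.≟ j))
  balance j j≤M with ℕₚ.<-cmp j r
  ... | tri< j<r _ _
    rewrite dec-false (r ℕ.≟ j) (ℕₚ.<⇒≢ j<r ∘ ≡.sym) | rate-low j<r
          | rate-low (ℕₚ.≤-<-trans (ℕₚ.m∸n≤m j 1) j<r)
          | rate-high {M ∸ j} (ℕₚ.m+n≤o⇒m≤o∸n s (ℕₚ.≤-trans (ℕₚ.+-monoʳ-≤ s (ℕₚ.<⇒≤ j<r)) (ℕₚ.≤-reflexive (ℕₚ.+-comm s r))))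
    = ≡.sym (ℕₚ.*-zeroʳ supply)
  ... | tri≈ _ ≡.refl _
    rewrite dec-true (r ℕ.≟ r) ≡.refl | rate-high {M ∸ r} (ℕₚ.≤-reflexive (≡.sym (ℕₚ.m+n∸m≡n r s)))
          | rate-low {r ∸ 1} (ℕₚ.≤-trans (ℕₚ.≤-reflexive (ℕₚ.m+[n∸m]≡n 1≤r)) ℕₚ.≤-refl)
    = ≡.trans (ℕₚ.+-identityʳ _) (≡.trans (ℕₚ.*-comm (rate r) (suc r)) (≡.sym (ℕₚ.*-identityʳ supply)))
  balance zero j≤M | tri> _ _ ()
  balance (suc i) i<M | tri> _ _ r<1+i
    rewrite dec-false (r ℕ.≟ suc i) (ℕₚ.<⇒≢ r<1+i) with suc i ≤? s
  ... | yes i<s = ≡.trans (rate-recurrence i (ℕₚ.≤-pred r<1+i) i<s)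
    (≡.sym (≡.trans (≡.cong (rate i * i +_) (ℕₚ.*-zeroʳ supply)) (ℕₚ.+-identityʳ _)))
  ... | no i≮s
    rewrite rate-high {suc i} (ℕₚ.<⇒≤ (ℕₚ.≰⇒> i≮s)) | rate-high {i} (ℕₚ.≤-pred (ℕₚ.≰⇒> i≮s))
          | rate-low {M ∸ suc i} (ℕₚ.m<n+o⇒m∸n<o M (suc i) {{ℕ.>-nonZero 1≤r}}
              (ℕₚ.≤-<-trans (ℕₚ.≤-reflexive (ℕₚ.+-comm r s)) (ℕₚ.+-monoˡ-< r (ℕₚ.≰⇒> i≮s))))
    = ≡.sym (ℕₚ.*-zeroʳ supply)

  fresh : Resource
  fresh = supply ⊛ token true r ⊕ supply ⊛ token false r

  balanced : Inputs M rate M ⊑ Outputs M rate M ⊕ fresh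
  balanced c j = ℕₚ.≤-trans (Inputs-≤ M rate c j) (bound (j ≤? M))
    where
    open ℕₚ.≤-Reasoning
    bound : Dec (j ≤ M) → rate j * suc j + rate (M ∸ j) ≤ Outputs M rate M c j + fresh c j
    bound (yes j≤M) = begin
      rate j * suc j + rate (M ∸ j) ≡⟨ balance j j≤M ⟩
      rate (j ∸ 1) * (j ∸ 1) + supply * bit (does (r ℕ.≟ j))
        ≡⟨ ≡.cong (rate (j ∸ 1) * (j ∸ 1) +_) (≡.trans
             (≡.cong (supply *_) (≡.sym (token-both r c j))) (ℕₚ.*-distribˡ-+ supply (token true r c j) _)) ⟩
      rate (j ∸ 1) * (j ∸ 1) + fresh c j
        ≤⟨ ℕₚ.+-monoˡ-≤ (fresh c j) (Outputs-≥ M rate c j j≤M) ⟩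
      Outputs M rate M c j + fresh c j ∎
    -- Beyond `M` the truncated `M ∸ j` is 0, which is below `r`, so both rates vanish.
    bound (no j≰M)
      rewrite rate-high {j} (ℕₚ.≤-trans s≤M (ℕₚ.<⇒≤ (ℕₚ.≰⇒> j≰M)))
            | rate-low {M ∸ j} (ℕₚ.≤-trans (s≤s (ℕₚ.≤-reflexive (ℕₚ.m≤n⇒m∸n≡0 (ℕₚ.<⇒≤ (ℕₚ.≰⇒> j≰M))))) 1≤r) = z≤n

  -- Summing `balance` over all `j ≤ M`, the terms `rate j * j` cancel against their shifted copies
  -- and twice the sum of the rates is left equal to `supply`. With `supply` fresh tokens on each
  -- side, a move costs two of them.
  moves-per-cycle : moves rate M ≡ supply
  moves-per-cycle = ℕₚ.+-cancelˡ-≡ weighted _ _ (begin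
    weighted + moves rate M
      ≡⟨ ≡.cong (weighted +_) (≡.trans (moves-≡ M rate M) (≡.cong₂ _+_ (≡.sym total) (≡.sym total))) ⟩
    weighted + (Σ< (suc M) rate + Σ< (suc M) rate)
      ≡⟨ ℕₚ.+-assoc weighted (Σ< (suc M) rate) _ ⟨
    weighted + Σ< (suc M) rate + Σ< (suc M) rate
      ≡⟨ ≡.cong₂ _+_ (≡.trans (≡.cong (_+ Σ< (suc M) rate) (≡.sym weighted′)) (≡.sym (Σ<-+ (suc M) _ rate))) (≡.sym (Σ<-reverse M rate)) ⟩
    Σ< (suc M) (λ j → rate j * j + rate j) + Σ< (suc M) (λ j → rate (M ∸ j))
      ≡⟨ Σ<-+ (suc M) (λ j → rate j * j + rate j) _ ⟨
    Σ< (suc M) (λ j → rate j * j + rate j + rate (M ∸ j))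
      ≡⟨ Σ<-cong (suc M) (λ j j<1+M → ≡.trans (≡.cong (_+ rate (M ∸ j))
           (≡.trans (ℕₚ.+-comm (rate j * j) _) (≡.sym (ℕₚ.*-suc (rate j) j)))) (balance j (ℕₚ.≤-pred j<1+M))) ⟩
    Σ< (suc M) (λ j → rate (j ∸ 1) * (j ∸ 1) + supply * bit (does (r ℕ.≟ j)))
      ≡⟨ Σ<-+ (suc M) (λ j → rate (j ∸ 1) * (j ∸ 1)) _ ⟩
    Σ< (suc M) (λ j → rate (j ∸ 1) * (j ∸ 1)) + Σ< (suc M) (λ j → supply * bit (does (r ℕ.≟ j)))
      ≡⟨ ≡.cong₂ _+_ (≡.trans (Σ<-head M _) (≡.cong (_+ weighted) (ℕₚ.*-zeroʳ (rate 0))))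
           (≡.trans (Σ<-cong (suc M) λ j _ → ≡.cong (λ b → supply * bit b) (does-≟-sym r j))
             (Σ<-at (suc M) (λ _ → supply) r (s≤s (ℕₚ.m≤m+n r s)))) ⟩
    weighted + supply ∎)
    where
    open ≡.≡-Reasoning
    weighted : ℕ
    weighted = Σ< M (λ j → rate j * j)
    rate-M : rate M ≡ 0
    rate-M = rate-high s≤M
    total : Σ< (suc M) rate ≡ Σ< M rate
    total = ≡.trans (≡.cong (Σ< M rate +_) rate-M) (ℕₚ.+-identityʳ _)
    weighted′ : Σ< (suc M) (λ j → rate j * j) ≡ weighted
    weighted′ = ≡.trans (≡.cong (λ x → weighted + x * M) rate-M) (ℕₚ.+-identityʳ _)
    does-≟-sym : ∀ i j → does (i ℕ.≟ j) ≡ does (j ℕ.≟ i)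
    does-≟-sym i j with i ℕ.≟ j
    ... | yes ≡.refl = ≡.refl
    ... | no i≢j = ≡.trans (dec-false (i ℕ.≟ j) i≢j) (≡.sym (dec-false (j ℕ.≟ i) (i≢j ∘ ≡.sym)))

  -- `excess r` is positive as `r < s`. Hence `K` cycles contain at least `K` moves.
  supply-pos : 1 ≤ supply
  supply-pos = ℕₚ.*-mono-≤ {1} {suc r} {1} {rate r} (s≤s z≤n) (ℕₚ.≤-trans
    (ℕₚ.*-mono-≤ {1} {_} {1} (ℕₚ.*-mono-≤ {1} {_} {1} (ℕₚ.*-mono-≤ {1} {_} {1}
      (quot-pos r 1≤r (ℕₚ.m≤m+n r s))
      (quot-pos (suc r) (s≤s z≤n) (ℕₚ.≤-trans r<s s≤M)))
      (≡.subst (λ k → 1 ≤ quot k) (≡.sym (ℕₚ.m+n∸m≡n r s)) (quot-pos s (ℕₚ.≤-trans 1≤r (ℕₚ.<⇒≤ r<s)) s≤M)))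
      (ℕₚ.m<n⇒0<n∸m (ℕₚ.*-mono-< r<s (s≤s r<s))))
    (ℕₚ.≤-reflexive (≡.sym (rate-mid ℕₚ.≤-refl))))
    where
    quot-pos : ∀ k → 1 ≤ k → k ≤ M → 1 ≤ quot k
    quot-pos k 1≤k k≤M with quot k in eq
    ... | suc _ = s≤s z≤n
    ... | zero  = ⊥-elim (ℕₚ.<⇒≢ (ℕₚ.1≤n! M)
      (≡.trans (≡.sym (ℕₚ.*-zeroʳ k)) (≡.trans (≡.cong (k *_) (≡.sym eq)) (quot-* k 1≤k k≤M))))

-- Filtered lists and linearity of expectation.

filter-map-filter-cong : ∀ {a b p q} {A : Set a} {B : Set b} (f : A → B)
  {P P′ : A → Set p} (P? : Decidable P) (P′? : Decidable P′) {Q : B → Set q} (Q? : Decidable Q) →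
  (∀ x → Q (f x) → does (P? x) ≡ does (P′? x)) →
  ∀ xs → filter Q? (map f (filter P? xs)) ≡ filter Q? (map f (filter P′? xs))
filter-map-filter-cong f P? P′? Q? eq [] = ≡.refl
filter-map-filter-cong f P? P′? Q? eq (x ∷ xs)
  with ih ← filter-map-filter-cong f P? P′? Q? eq xs with Q? (f x)
... | yes qx rewrite ≡.sym (eq x qx) with does (P? x)
...   | true  rewrite dec-true (Q? (f x)) qx = ≡.cong (f x ∷_) ih
...   | false = ih
filter-map-filter-cong f P? P′? Q? eq (x ∷ xs) | no ¬qx with does (P? x) | does (P′? x)
...   | true  | true  rewrite dec-false (Q? (f x)) ¬qx = ih
...   | true  | false rewrite dec-false (Q? (f x)) ¬qx = ih
...   | false | true  rewrite dec-false (Q? (f x)) ¬qx = ih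
...   | false | false = ih

module Expectation {c ℓ₁ ℓ₂ a p} (R : RealField c ℓ₁ ℓ₂) (P : ProbabilitySpace R a p) where

  open RealField R hiding (zero)
  open OrderedField R
  open ProbabilitySpace P
  open FullyOnline R using (integrable-sum; value)

  -- `𝔼` takes a proof of integrability as argument; monotonicity in both directions also gives
  -- independence of that proof.
  𝔼-cong : ∀ {X Y} i j → (∀ ω → X ω ≈ Y ω) → 𝔼 X i ≈ 𝔼 Y j
  𝔼-cong i j eq = ≤-antisym (𝔼-mono i j λ ω → ≤-reflexive (eq ω))
                            (𝔼-mono j i λ ω → ≤-reflexive (sym (eq ω)))

  𝔼-sum : ∀ {m} (X : Ω → Fin m → ℝ) (int : ∀ k → Integrable (λ ω → X ω k)) i →
    𝔼 (λ ω → sum (X ω)) i ≈ sum (λ k → 𝔼 (λ ω → X ω k) (int k))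
  𝔼-sum {zero}  X int i = 𝔼-const 0# i
  𝔼-sum {suc m} X int i =
    trans (𝔼-+ (int zero) (integrable-sum P (λ ω → X ω ∘ suc) (int ∘ suc)) i)
          (+-congˡ (𝔼-sum (λ ω → X ω ∘ suc) (int ∘ suc) _))

  integrable-guard : ∀ b {X} → Integrable X → Integrable (λ ω → guard b (X ω))
  integrable-guard true  i = i
  integrable-guard false i = integrable-const 0#

  𝔼-guard : ∀ b {X} i j → 𝔼 (λ ω → guard b (X ω)) j ≈ guard b (𝔼 X i)
  𝔼-guard true  i j = 𝔼-cong j i λ _ → refl
  𝔼-guard false i j = 𝔼-const 0# j

  𝔼-value : ∀ {m} (x : Ω → Fin m → Fin m → ℝ) (int : ∀ u v → Integrable (λ ω → x ω u v)) i →
    𝔼 (λ ω → value (x ω)) i ≈ value (λ u v → 𝔼 (λ ω → x ω u v) (int u v))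
  𝔼-value x int i = trans (𝔼-sum _ rows i) (sum-cong-≋ λ u → trans (𝔼-sum _ (cells u) (rows u))
      (sum-cong-≋ λ v → 𝔼-guard (does (u <? v)) (int u v) (cells u v)))
    where
    cells : ∀ u v → Integrable (λ ω → guard (does (u <? v)) (x ω u v))
    cells u v = integrable-guard (does (u <? v)) (int u v)
    rows : ∀ u → Integrable (λ ω → sum λ v → guard (does (u <? v)) (x ω u v))
    rows u = integrable-sum P _ (cells u)

-- Layouts as instances, and what their hidden histories reveal.

module LayoutInstance {c ℓ₁ ℓ₂} (R : RealField c ℓ₁ ℓ₂) {n : ℕ} {side : Fin n → Bool} where

  open RealField R hiding (zero)
  open OrderedField R
  open FullyOnline R
  open Layout

  -- All times are `0#`, so the conditions on times hold trivially and the processing order alone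
  -- carries the structure: first the arrivals by name, then the deadlines in the order `σ`.
  toInstance : Layout side → Instance
  toInstance D = record
    { n = n ; graph = graph D ; r = λ _ → 0# ; d = λ _ → 0#
    ; order = mk↔ₛ′ to from to∘from from∘to
    ; r≤d = λ _ → ≤-refl
    ; intersecting = λ _ _ _ → ≤-refl , ≤-refl
    ; chronological = λ e f _ → ≤-reflexive (trans (time≈0 e) (sym (time≈0 f)))
    ; arrival-first = λ v → arrival<deadline v v
    ; edge-available = λ u v _ → arrival<deadline u v }
    where
    to : Event n → Fin (n ℕ.+ n)
    to (arrival v)  = v ↑ˡ n
    to (deadline v) = n ↑ʳ (σ D ⟨$⟩ˡ v)
    from : Fin (n ℕ.+ n) → Event n
    from k = [ arrival , (λ j → deadline (σ D ⟨$⟩ʳ j)) ]′ (splitAt n k)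
    to∘from : ∀ k → to (from k) ≡ k
    to∘from k with splitAt n k in eq
    ... | inj₁ v = ≡.trans (≡.cong (join n n) (≡.sym eq)) (join-splitAt n n k)
    ... | inj₂ j = ≡.trans (≡.cong (n ↑ʳ_) (inverseˡ (σ D)))
      (≡.trans (≡.cong (join n n) (≡.sym eq)) (join-splitAt n n k))
    from∘to : ∀ e → from (to e) ≡ e
    from∘to (arrival v)  rewrite splitAt-↑ˡ n v n = ≡.refl
    from∘to (deadline v) rewrite splitAt-↑ʳ n n (σ D ⟨$⟩ˡ v) = ≡.cong deadline (inverseʳ (σ D))
    time≈0 : ∀ (e : Event n) → Event-rec (λ _ → 0#) (λ _ → 0#) e ≈ 0#
    time≈0 (arrival _)  = refl
    time≈0 (deadline _) = refl
    arrival<deadline : ∀ u v → toℕ (to (arrival u)) ℕ.< toℕ (to (deadline v))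
    arrival<deadline u v rewrite toℕ-↑ˡ u n | toℕ-↑ʳ n (σ D ⟨$⟩ˡ v) =
      ℕₚ.<-≤-trans (toℕ<n u) (ℕₚ.m≤m+n n _)

  toInstance-bipartite : ∀ D → Bipartite (toInstance D)
  toInstance-bipartite D = side , bipartite D

  -- The local function of `hide` with the expired vertices as a parameter, so that this list and
  -- the observations can be compared separately.
  concealed : List ℕ → Observation → Observation
  concealed E (arrives t v us) = arrives t v (filter (λ u → v ∈? E ⊎-dec u ∈? E) us)
  concealed E (expires t v)    = expires t v

  hide-≡ : ∀ h → hide h ≡ map (concealed (expired h)) h
  hide-≡ h = map-cong (λ { (arrives _ _ _) → ≡.refl ; (expires _ _) → ≡.refl }) h

  module _ {t : ℕ} {D D′ : Layout side} (agree : AgreeBelow t D D′) where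

    open AgreeBelow agree

    observation observation′ : Fin (n ℕ.+ n) → Observation
    observation  = observe (toInstance D)  ∘ Instance.event (toInstance D)
    observation′ = observe (toInstance D′) ∘ Instance.event (toInstance D′)

    -- The `n` arrivals and the first `t` deadlines.
    Early : Fin (n ℕ.+ n) → Set
    Early k = toℕ k ℕ.< n ℕ.+ t

    early-deadline : ∀ {k j} → Early k → splitAt n k ≡ inj₂ j → toℕ j ℕ.< t
    early-deadline {k} {j} early eq = ℕₚ.+-cancelˡ-< n _ _ (≡.subst (ℕ._< n ℕ.+ t)
      (≡.trans (≡.cong toℕ (≡.trans (≡.sym (join-splitAt n n k)) (≡.cong (join n n) eq))) (toℕ-↑ʳ n j)) early)

    expired-agree : ∀ {ks} → All Early ks → expired (map observation′ ks) ≡ expired (map observation ks)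
    expired-agree [] = ≡.refl
    expired-agree {k ∷ _} (early ∷ rest) with splitAt n k in eq
    ... | inj₁ v = expired-agree rest
    ... | inj₂ j = ≡.cong₂ (λ v → toℕ v ∷_) (same-order j (early-deadline early eq)) (expired-agree rest)

    expired-early : ∀ {ks} → All Early ks →
      All (λ v → ∃ λ j → toℕ j ℕ.< t × v ≡ toℕ (σ D ⟨$⟩ʳ j)) (expired (map observation ks))
    expired-early [] = []
    expired-early {k ∷ _} (early ∷ rest) with splitAt n k in eq
    ... | inj₁ v = expired-early rest
    ... | inj₂ j = (j , early-deadline early eq , ≡.refl) ∷ expired-early rest

    adj-agree : ∀ {v E} → All (λ v → ∃ λ j → toℕ j ℕ.< t × v ≡ toℕ (σ D ⟨$⟩ʳ j)) E →
      toℕ v ∈ E → ∀ u → adj D′ v u ≡ adj D v u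
    adj-agree all-early v∈E u with j , j<t , eq ← All.lookup all-early v∈E
      rewrite toℕ-injective eq = same-edges j j<t u

    -- Neighbour lists need to agree only on edges that survive concealment. Such an edge has an
    -- expired endpoint, at which both layouts have the same edges; if that endpoint is the
    -- neighbour, symmetry of adjacency is applied first.
    concealed-agree : ∀ {E} → All (λ v → ∃ λ j → toℕ j ℕ.< t × v ≡ toℕ (σ D ⟨$⟩ʳ j)) E →
      ∀ k → Early k → concealed E (observation′ k) ≡ concealed E (observation k)
    concealed-agree {E} all-early k early with splitAt n k in eq
    ... | inj₂ j = ≡.cong (λ v → expires 0# (toℕ v)) (same-order j (early-deadline early eq))
    ... | inj₁ v = ≡.cong (arrives 0# (toℕ v)) (filter-map-filter-cong toℕ _ _
        (λ u → toℕ v ∈? E ⊎-dec u ∈? E) same (allFin n))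
      where
      same : ∀ u → toℕ v ∈ E ⊎ toℕ u ∈ E →
        does (T? (adj D′ v u) ×-dec ((u ↑ˡ n) <? (v ↑ˡ n))) ≡
        does (T? (adj D v u) ×-dec ((u ↑ˡ n) <? (v ↑ˡ n)))
      same u (inj₁ v∈E) rewrite adj-agree all-early v∈E u = ≡.refl
      same u (inj₂ u∈E) rewrite symmetric D′ v u | symmetric D v u | adj-agree all-early u∈E v = ≡.refl

    hidden-history-agree : ∀ i → Early i →
      hide (history (toInstance D′) i) ≡ hide (history (toInstance D) i)
    hidden-history-agree i early = begin
      hide (map observation′ ks)
        ≡⟨ hide-≡ (map observation′ ks) ⟩
      map (concealed (expired (map observation′ ks))) (map observation′ ks)
        ≡⟨ ≡.cong (λ E → map (concealed E) (map observation′ ks)) (expired-agree ks-early) ⟩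
      map (concealed E) (map observation′ ks)
        ≡⟨ map-∘ ks ⟨
      map (concealed E ∘ observation′) ks
        ≡⟨ map-cong-local (All.map (λ {k} → concealed-agree (expired-early ks-early) k) ks-early) ⟩
      map (concealed E ∘ observation) ks
        ≡⟨ map-∘ ks ⟩
      map (concealed E) (map observation ks)
        ≡⟨ hide-≡ (map observation ks) ⟨
      hide (map observation ks) ∎
      where
      open ≡.≡-Reasoning
      ks : List (Fin (n ℕ.+ n))
      ks = filter (Finₚ._≤? i) (allFin (n ℕ.+ n))
      ks-early : All Early ks
      ks-early = All.map (λ k≤i → ℕₚ.≤-<-trans k≤i early) (all-filter (Finₚ._≤? i) (allFin (n ℕ.+ n)))
      E : List ℕ
      E = expired (map observation ks)

-- The expected output as a response in the token game.

module Response {c ℓ₁ ℓ₂ a p} (R : RealField c ℓ₁ ℓ₂) (P : ProbabilitySpace R a p)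
  (A : FullyOnline.OnlineAlgorithm R P (FullyOnline.Bipartite R))
  (independent : FullyOnline.InterAvailableIndependent R P A)
  {n : ℕ} (side : Fin n → Bool) where

  open RealField R hiding (zero)
  open OrderedField R
  open FullyOnline R
  open ProbabilitySpace P
  open Expectation R P
  open LayoutInstance R {n} {side}
  open Layout
  open OnlineAlgorithm A using (increase; increment; output; available; feasible; integrable)

  output-integrable : ∀ D u v → Integrable (λ ω → output ω (toInstance D) u v)
  output-integrable D u v = integrable-sum P (λ ω i → increment ω (toInstance D) i u v)
    λ i → integrable (toInstance D) (toInstance-bipartite D) i u v

  -- Randomness is averaged out at once: the adversary adapts to expected values and not to random
  -- bits, so the instance it ends with is a fixed one.
  expectedOutput : Layout side → Fin n → Fin n → ℝ
  expectedOutput D u v = 𝔼 (λ ω → output ω (toInstance D) u v) (output-integrable D u v)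

  expectedOutput-matching : ∀ D → IsFractionalMatching (graph D) (expectedOutput D)
  expectedOutput-matching D = record
    { symm     = λ u v → 𝔼-cong _ _ λ ω → symm (matching ω) u v
    ; support  = λ u v ¬e → trans (𝔼-cong _ (integrable-const 0#) λ ω → support (matching ω) u v ¬e)
                                  (𝔼-const 0# _)
    ; nonneg   = λ u v → ≤-trans (≤-reflexive (sym (𝔼-const 0# (integrable-const 0#))))
                                 (𝔼-mono _ _ λ ω → nonneg (matching ω) u v)
    ; capacity = λ u → ≤-trans
        (≤-reflexive (sym (𝔼-sum (λ ω → output ω (toInstance D) u) (output-integrable D u)
          (integrable-sum P (λ ω → output ω (toInstance D) u) (output-integrable D u)))))
        (≤-trans (𝔼-mono _ (integrable-const 1#) λ ω → capacity (matching ω) u)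
                 (≤-reflexive (𝔼-const 1# _))) }
    where
    open IsFractionalMatching
    matching : ∀ ω → IsFractionalMatching (graph D) (output ω (toInstance D))
    matching ω = feasible ω (toInstance D) (toInstance-bipartite D)

  -- Increments are compared event by event. Up to the `t`-th deadline the hidden histories coincide
  -- and independence applies; afterwards the vertex has expired in both layouts and its increments
  -- vanish.
  output-local : ∀ ω t D D′ → AgreeBelow t D D′ → ∀ j → toℕ j ℕ.< t → ∀ v →
    output ω (toInstance D′) (σ D ⟨$⟩ʳ j) v ≈ output ω (toInstance D) (σ D ⟨$⟩ʳ j) v
  output-local ω t D D′ agree j j<t v = sum-cong-≋ same
    where
    u : Fin n
    u = σ D ⟨$⟩ʳ j
    gone : ∀ E → turn E u ≡ toℕ j → ∀ i → ¬ toℕ i ℕ.< n ℕ.+ t →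
      increment ω (toInstance E) i u v ≈ 0#
    gone E turn-u i late = available ω (toInstance E) (toInstance-bipartite E) i u v
      λ { (_ , (_ , i≤deadline) , _) → late (ℕₚ.≤-<-trans i≤deadline
            (≡.subst (ℕ._< n ℕ.+ t) (≡.sym (≡.trans (toℕ-↑ʳ n (σ E ⟨$⟩ˡ u)) (≡.cong (n ℕ.+_) turn-u)))
              (ℕₚ.+-monoʳ-< n j<t))) }
    turn-D : turn D u ≡ toℕ j
    turn-D = ≡.cong toℕ (inverseˡ (σ D))
    turn-D′ : turn D′ u ≡ toℕ j
    turn-D′ = ≡.cong toℕ (≡.trans (≡.cong (σ D′ ⟨$⟩ˡ_) (≡.sym (AgreeBelow.same-order agree j j<t))) (inverseˡ (σ D′)))
    same : ∀ i → increment ω (toInstance D′) i u v ≈ increment ω (toInstance D) i u v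
    same i with toℕ i ℕ.<? n ℕ.+ t
    ... | no late = trans (gone D′ turn-D′ i late) (sym (gone D turn-D i late))
    ... | yes early = trans (independent ω (history (toInstance D′) i) (toℕ u) (toℕ v)) (trans
      (reflexive (≡.cong (λ h → increase ω h (toℕ u) (toℕ v)) (hidden-history-agree agree i early)))
      (sym (independent ω (history (toInstance D) i) (toℕ u) (toℕ v))))

  expectedOutput-local : ∀ t D D′ → AgreeBelow t D D′ → ∀ j → toℕ j ℕ.< t → ∀ v →
    expectedOutput D′ (σ D ⟨$⟩ʳ j) v ≈ expectedOutput D (σ D ⟨$⟩ʳ j) v
  expectedOutput-local t D D′ agree j j<t v =
    𝔼-cong _ _ λ ω → output-local ω t D D′ agree j j<t v

  expectedValue-≈ : ∀ D C → expectedValue P A (toInstance D) C ≈ value (expectedOutput D)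
  expectedValue-≈ D C = 𝔼-value (λ ω → output ω (toInstance D)) (output-integrable D) _

-- Initial vertex sets with prescribed tokens.

module Population where
  open import Data.Nat using (_+_; _*_)

  record Population (C : Resource) (W : ℕ) : Set where
    field
      size     : ℕ
      side     : Fin size → Bool
      weight   : Fin size → ℕ
      contains : C ⊑ census side weight
      total    : sumℕ weight ≡ W

  open Population

  nobody : Population (λ _ _ → 0) 0
  nobody = record { size = 0 ; side = λ () ; weight = λ () ; contains = λ _ _ → z≤n ; total = ≡.refl }

  shrink : ∀ {C D W} → D ⊑ C → Population C W → Population D W
  shrink D⊑C p = record
    { size = size p ; side = side p ; weight = weight p
    ; contains = λ b j → ℕₚ.≤-trans (D⊑C b j) (contains p b j) ; total = total p }

  add : ∀ {C W} b j → Population C W → Population (C ⊕ token b j) (j + W)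
  add {C} b j p = record
    { size = suc (size p) ; side = b Vector.∷ side p ; weight = j Vector.∷ weight p
    ; contains = λ c k → ℕₚ.≤-trans (ℕₚ.≤-reflexive (ℕₚ.+-comm (C c k) _))
        (ℕₚ.+-monoʳ-≤ (token b j c k) (contains p c k))
    ; total = ≡.cong (j +_) (total p) }

  add-many : ∀ {C W} k b j → Population C W → Population (C ⊕ k ⊛ token b j) (k * j + W)
  add-many {C} zero    b j p = shrink (λ c i → ℕₚ.≤-reflexive (ℕₚ.+-identityʳ (C c i))) p
  add-many {C} {W} (suc k) b j p = ≡.subst (Population _) (≡.sym (ℕₚ.+-assoc j (k * j) W))
    (shrink (λ c i → ℕₚ.≤-reflexive (≡.trans
        (≡.cong (C c i +_) (ℕₚ.+-comm (token b j c i) _)) (≡.sym (ℕₚ.+-assoc (C c i) _ _))))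
      (add b j (add-many k b j p)))

  -- The total weight of the permanent stock is left implicit: what matters is that it is fixed
  -- before the number of cycles is chosen.
  populate-outputs : ∀ M rate k → ∃ λ W → Population (Outputs M rate k) W
  populate-outputs M rate zero    = 0 , nobody
  populate-outputs M rate (suc k) with W , p ← populate-outputs M rate k =
    _ , shrink (λ c j → ℕₚ.≤-reflexive (regroup (Outputs M rate k c j) (rate k) k _ _))
      (add-many (rate k * k) true (suc k) (add-many (rate k * k) false (suc k) p))
    where
    open Data.Nat.Solver.+-*-Solver
    regroup : ∀ o ρ k x y → o + (ρ * (k * x) + ρ * (k * y)) ≡ o + ρ * k * x + ρ * k * y
    regroup = solve 5 (λ o ρ k x y →
      o :+ (ρ :* (k :* x) :+ ρ :* (k :* y)) := o :+ ρ :* k :* x :+ ρ :* k :* y) ≡.refl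

  add-both-sides : ∀ {C W} k g j → Population C W →
    Population (C ⊕ k ⊛ (g ⊛ token true j ⊕ g ⊛ token false j)) (k * g * j + (k * g * j + W))
  add-both-sides {C} k g j p =
    shrink (λ c i → ℕₚ.≤-reflexive (regroup (C c i) k g (token true j c i) (token false j c i)))
      (add-many (k * g) false j (add-many (k * g) true j p))
    where
    open Data.Nat.Solver.+-*-Solver
    regroup : ∀ o k g x y → o + k * (g * x + g * y) ≡ o + k * g * x + k * g * y
    regroup = solve 5 (λ o k g x y → o :+ k :* (g :* x :+ g :* y) := o :+ k :* g :* x :+ k :* g :* y) ≡.refl

-- Solutions of Pell's equation and the estimate of √2.

module Triangular where
  open import Data.Nat using (_+_; _*_; _<_)
  open Data.Nat.Solver.+-*-Solver

  -- Pell's equation: (2 (r + s) + 1)² + 1 = 2 (2 s + 1)².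
  record HalfTriangular (N : ℕ) : Set where
    field
      r s        : ℕ
      N<r        : N < r
      r<s        : r < s
      triangular : (r + s) * suc (r + s) ≡ 2 * (s * suc s)

  halfTriangular : ∀ N → HalfTriangular N
  halfTriangular zero    = record { r = 1 ; s = 2 ; N<r = s≤s z≤n ; r<s = s≤s (s≤s z≤n) ; triangular = ≡.refl }
  halfTriangular (suc N) = record
    -- With `x = 2 (r + s) + 1` and `y = 2 s + 1` this is the map to `3 x + 4 y` and `2 x + 3 y`,
    -- that is, multiplication of `x + y √2` by the unit `3 + 2 √2`.
    { r = r + 2 * s + 1
    ; s = 2 * r + 5 * s + 2
    ; N<r = ℕₚ.≤-<-trans N<r (ℕₚ.≤-<-trans (ℕₚ.m≤m+n r (2 * s))
        (ℕₚ.≤-reflexive (ℕₚ.+-comm 1 (r + 2 * s))))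
    ; r<s = ℕₚ.≤-trans (ℕₚ.m≤m+n (suc (r + 2 * s + 1)) (r + 3 * s))
        (ℕₚ.≤-reflexive (solve 2 (λ r s → con 1 :+ (r :+ con 2 :* s :+ con 1) :+ (r :+ con 3 :* s) :=
                                          con 2 :* r :+ con 5 :* s :+ con 2) ≡.refl r s))
    -- The difference of the two sides is the same for the new pair as for the old; in
    -- subtraction-free form this is a polynomial identity.
    ; triangular = ℕₚ.+-cancelʳ-≡ (2 * (s * suc s)) _ _ (≡.trans
        (solve 2 (λ r s →
          (r :+ con 2 :* s :+ con 1 :+ (con 2 :* r :+ con 5 :* s :+ con 2)) :*
            (con 1 :+ (r :+ con 2 :* s :+ con 1 :+ (con 2 :* r :+ con 5 :* s :+ con 2))) :+
            con 2 :* (s :* (con 1 :+ s)) :=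
          con 2 :* ((con 2 :* r :+ con 5 :* s :+ con 2) :* (con 1 :+ (con 2 :* r :+ con 5 :* s :+ con 2))) :+
            (r :+ s) :* (con 1 :+ (r :+ s))) ≡.refl r s)
        (≡.cong (2 * ((2 * r + 5 * s + 2) * suc (2 * r + 5 * s + 2)) +_) triangular)) }
    where open HalfTriangular (halfTriangular N)

  -- By the equation, `(2 s + 1)²` is `2 M² + 2 M + 1`.
  √2-estimate : ∀ M s → M * suc M ≡ 2 * (s * suc s) → 2 * (M * M) < (2 * s + 1) * (2 * s + 1)
  √2-estimate M s eq = ℕₚ.≤-trans (ℕₚ.m≤m+n _ (2 * M)) (ℕₚ.≤-reflexive (≡.trans
    (solve 1 (λ M → con 1 :+ con 2 :* (M :* M) :+ con 2 :* M := con 2 :* (M :* (con 1 :+ M)) :+ con 1) ≡.refl M)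
    (≡.trans (≡.cong (λ x → 2 * x + 1) eq)
      (solve 1 (λ s → con 2 :* (con 2 :* (s :* (con 1 :+ s))) :+ con 1 :=
                      (con 2 :* s :+ con 1) :* (con 2 :* s :+ con 1)) ≡.refl s))))

-- Choice of the parameters that beat a given ratio.

module HardInstances {c ℓ₁ ℓ₂} (R : RealField c ℓ₁ ℓ₂) (Γ : RealField.ℝ R) where

  open RealField R hiding (zero)
  open OrderedField R
  open Solver using (_:+_; _:*_; con; solve; _:=_)
  open Triangular

  ι-2 : ι 2 ≈ 1# + 1#
  ι-2 = +-congˡ (+-identityʳ 1#)

  exceed : ∀ {η} → 0# <ᵣ η → ∀ x → ∃ λ N → ∀ m → N ℕ.≤ m → x <ᵣ η * ι m
  exceed {η} 0<η x with y , ηy≈1 ← positive-invertible 0<η with N , lt ← archimedean (x * y) =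
    N , λ m N≤m → <-respˡ
      (trans (solve 3 (λ η x y → η :* (x :* y) := x :* (η :* y)) refl η x y) (trans (*-congˡ ηy≈1) (*-identityʳ x)))
      (*-monoˡ-< 0<η (<-≤-trans lt (ι-mono N≤m)))

  module _ (√2 : ℝ) (√2²≈2 : √2 * √2 ≈ 1# + 1#) (2-√2<Γ : (1# + 1#) - √2 <ᵣ Γ) where

    δ : ℝ
    δ = Γ - ((1# + 1#) - √2)

    0<δ : 0# <ᵣ δ
    0<δ = x<y⇒0<y-x 2-√2<Γ

    Γ+√2 : Γ + √2 ≈ δ + ι 2
    Γ+√2 = begin-equality
      Γ + √2                            ≈⟨ +-congʳ (x-y+y≈x Γ _) ⟨
      δ + ((1# + 1#) - √2) + √2         ≈⟨ +-assoc _ _ _ ⟩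
      δ + ((1# + 1#) - √2 + √2)         ≈⟨ +-congˡ (trans (x-y+y≈x (1# + 1#) √2) (sym ι-2)) ⟩
      δ + ι 2                           ∎
      where open ≤-Reasoning

    -- Otherwise squaring would give `(2 s + 1)² < 2 M²`, against `√2-estimate`.
    √2-bound : ∀ M s → M ℕ.* suc M ≡ 2 ℕ.* (s ℕ.* suc s) → √2 * ι M ≤ᵣ ι (2 ℕ.* s ℕ.+ 1)
    √2-bound M s eq a<Z = ι-mono (ℕₚ.<⇒≤ (√2-estimate M s eq))
      (<-respˡ (sym (ι-* a a)) (<-respʳ Z² (<-trans (*-monoˡ-< 0<a a<Z)
        (<-respˡ (*-comm _ _) (*-monoˡ-< (<-trans 0<a a<Z) a<Z)))))
      where
      a = 2 ℕ.* s ℕ.+ 1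
      Z = √2 * ι M
      0<a : 0# <ᵣ ι a
      0<a = ι-pos (ℕₚ.m≤n+m 1 (2 ℕ.* s))
      Z² : Z * Z ≈ ι (2 ℕ.* (M ℕ.* M))
      Z² = begin-equality
        Z * Z                       ≈⟨ solve 2 (λ q m → q :* m :* (q :* m) := q :* q :* (m :* m)) refl √2 (ι M) ⟩
        √2 * √2 * (ι M * ι M)       ≈⟨ *-cong (trans √2²≈2 (sym ι-2)) (sym (ι-* M M)) ⟩
        ι 2 * ι (M ℕ.* M)           ≈⟨ ι-* 2 (M ℕ.* M) ⟨
        ι (2 ℕ.* (M ℕ.* M))         ∎
        where open ≤-Reasoning

    -- With `√2 * ι M` added to both sides, the left side is at most `2 r + 2 s + 1 = 2 M + 1` and
    -- the right side is `(δ + 2) M`. So `δ M > 1` suffices, which holds for all large `r`.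
    good-ratio : ∃ λ N → ∀ r s → N ℕ.≤ r → (r ℕ.+ s) ℕ.* suc (r ℕ.+ s) ≡ 2 ℕ.* (s ℕ.* suc s) →
      ι (2 ℕ.* r) <ᵣ Γ * ι (r ℕ.+ s)
    good-ratio with N , large ← exceed 0<δ 1# = N , λ r s N≤r eq →
      let M = r ℕ.+ s in
      +-cancelʳ-< (√2 * ι M) (≤-<-trans
        (≤-trans (+-monoʳ-≤ (ι (2 ℕ.* r)) (√2-bound M s eq)) (≤-reflexive (begin-equality
          ι (2 ℕ.* r) + ι (2 ℕ.* s ℕ.+ 1)      ≈⟨ ι-+ (2 ℕ.* r) (2 ℕ.* s ℕ.+ 1) ⟨
          ι (2 ℕ.* r ℕ.+ (2 ℕ.* s ℕ.+ 1))      ≈⟨ ι-cong (regroup r s) ⟩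
          1# + ι (2 ℕ.* M)                     ≈⟨ +-congˡ (ι-* 2 M) ⟩
          1# + ι 2 * ι M                       ∎)))
        (<-respʳ (begin-equality
          δ * ι M + ι 2 * ι M                  ≈⟨ distribʳ (ι M) δ (ι 2) ⟨
          (δ + ι 2) * ι M                      ≈⟨ *-congʳ Γ+√2 ⟨
          (Γ + √2) * ι M                       ≈⟨ distribʳ (ι M) Γ √2 ⟩
          Γ * ι M + √2 * ι M                   ∎)
          (+-monoˡ-< (ι 2 * ι M) (large M (ℕₚ.≤-trans N≤r (ℕₚ.m≤m+n r s))))))
      where
      open ≤-Reasoning
      regroup : ∀ r s → 2 ℕ.* r ℕ.+ (2 ℕ.* s ℕ.+ 1) ≡ suc (2 ℕ.* (r ℕ.+ s))
      regroup r s = ≡.trans (≡.sym (ℕₚ.+-assoc (2 ℕ.* r) _ 1))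
        (≡.trans (ℕₚ.+-comm _ 1) (≡.cong suc (≡.sym (ℕₚ.*-distribˡ-+ 2 r s))))

-- The contradiction with competitiveness.

module NotCompetitive {c ℓ₁ ℓ₂ a p} (R : RealField c ℓ₁ ℓ₂) (P : ProbabilitySpace R a p)
  (A : FullyOnline.OnlineAlgorithm R P (FullyOnline.Bipartite R))
  (independent : FullyOnline.InterAvailableIndependent R P A)
  (Γ : RealField.ℝ R) (competitive : FullyOnline.Competitive R P A Γ) where

  open RealField R hiding (zero)
  open OrderedField R
  open FullyOnline R using (value)
  open HardInstances R Γ using (exceed)
  open Population
  open Population.Population

  -- After `K` cycles the optimum is `τ`, while `M` times the value is at most the initial weight
  -- `2 r τ + c₀`. Competitiveness would give `Γ M τ ≤ 2 r τ + c₀`, which fails for large `K`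
  -- because `c₀` does not depend on `K`.
  ratio-bound : ∀ r s → 1 ℕ.≤ r → r ℕ.< s → (r ℕ.+ s) ℕ.* suc (r ℕ.+ s) ≡ 2 ℕ.* (s ℕ.* suc s) →
    ¬ ι (2 ℕ.* r) <ᵣ Γ * ι (r ℕ.+ s)
  ratio-bound r s 1≤r r<s triangular lt
    with c₀ , outputs ← populate-outputs (r ℕ.+ s) (Rates.rate r s 1≤r r<s triangular) (r ℕ.+ s)
    with K , large ← exceed (x<y⇒0<y-x lt) (ι c₀) =
    -- The goal is `⊥`, so the doubly negated final state can be handed to `refute`.
    cycles K (initial-state (weight population) (total population) (contains population)) λ S → refute (retime steps S)
    where
    open Rates r s 1≤r r<s triangular
    τ W₀ : ℕ
    τ  = K ℕ.* supply
    W₀ = τ ℕ.* r ℕ.+ (τ ℕ.* r ℕ.+ c₀)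
    η : ℝ
    η = Γ * ι M - ι (2 ℕ.* r)
    population : Population (Outputs M rate M ⊕ K ⊛ fresh) W₀
    population = add-both-sides K supply r outputs

    open Response R P A independent (side population)
    open LayoutInstance R using (toInstance; toInstance-bipartite)
    open Game R (side population) M W₀ expectedOutput expectedOutput-matching expectedOutput-local
    open Cycles rate rate-ok fresh balanced
    open ≤-Reasoning

    K≤τ : K ℕ.≤ τ
    K≤τ = ℕₚ.≤-trans (ℕₚ.≤-reflexive (≡.sym (ℕₚ.*-identityʳ K))) (ℕₚ.*-monoʳ-≤ K supply-pos)

    ι-W₀ : ι W₀ ≈ ι (2 ℕ.* r) * ι τ + ι c₀
    ι-W₀ = trans (ι-cong (≡.trans (≡.sym (ℕₚ.+-assoc (τ ℕ.* r) _ c₀))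
             (≡.cong (ℕ._+ c₀) (≡.trans (≡.sym (ℕₚ.*-distribˡ-+ τ r r))
               (≡.trans (ℕₚ.*-comm τ (r ℕ.+ r)) (≡.cong (λ x → (r ℕ.+ x) ℕ.* τ) (≡.sym (ℕₚ.+-identityʳ r))))))))
           (trans (ι-+ (2 ℕ.* r ℕ.* τ) c₀) (+-congʳ (ι-* (2 ℕ.* r) τ)))

    steps : K ℕ.* moves rate M ℕ.+ 0 ≡ τ
    steps = ≡.trans (ℕₚ.+-identityʳ _) (≡.cong (K ℕ.*_) moves-per-cycle)

    refute : ∀ {C} → ¬ State τ C
    refute S = too-small (<-respˡ (trans (+-comm _ _) (sym ι-W₀))
        (<-respʳ surplus (+-monoˡ-< (ι (2 ℕ.* r) * ι τ) (large τ K≤τ))))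
      where
      D : Layout (side population)
      D = State.layout S
      surplus : η * ι τ + ι (2 ℕ.* r) * ι τ ≈ ι M * (Γ * ι τ)
      surplus = begin-equality
        η * ι τ + ι (2 ℕ.* r) * ι τ   ≈⟨ distribʳ (ι τ) η (ι (2 ℕ.* r)) ⟨
        (η + ι (2 ℕ.* r)) * ι τ       ≈⟨ *-congʳ (x-y+y≈x (Γ * ι M) (ι (2 ℕ.* r))) ⟩
        Γ * ι M * ι τ                 ≈⟨ trans (*-congʳ (*-comm Γ (ι M))) (*-assoc (ι M) Γ (ι τ)) ⟩
        ι M * (Γ * ι τ)               ∎
      too-small : ι M * (Γ * ι τ) ≤ᵣ ι W₀
      too-small = begin
        ι M * (Γ * ι τ)              ≤⟨ ι-*-mono M (competitive (toInstance D) (toInstance-bipartite D)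
                                          (ι τ) (optimum S)) ⟩
        ι M * FullyOnline.expectedValue R P A (toInstance D) (toInstance-bipartite D)
                                     ≈⟨ *-congˡ (expectedValue-≈ D (toInstance-bipartite D)) ⟩
        ι M * value (expectedOutput D) ≤⟨ value-bound S ⟩
        ι W₀ ∎

corollary3p6 :
  {c ℓ₁ ℓ₂ a p : Level} (R : RealField c ℓ₁ ℓ₂) →
  let open RealField R
      open FullyOnline R
  in
  (√2 : ℝ) → 0# ≤ᵣ √2 → √2 * √2 ≈ 1# + 1# →
  (Γ : ℝ) → (1# + 1#) - √2 <ᵣ Γ →
  (P : ProbabilitySpace R a p) →
  ¬ (Σ (OnlineAlgorithm P Bipartite) λ A →
       InterAvailableIndependent P A × Competitive P A Γ)
corollary3p6 R √2 _ √2²≈2 Γ 2-√2<Γ P (A , independent , competitive)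
  with N , good ← HardInstances.good-ratio R Γ √2 √2²≈2 2-√2<Γ
  with record { r = r ; s = s ; N<r = N<r ; r<s = r<s ; triangular = triangular } ← Triangular.halfTriangular N =
  NotCompetitive.ratio-bound R P A independent Γ competitive r s
    (ℕₚ.≤-<-trans z≤n N<r) r<s triangular (good r s (ℕₚ.<⇒≤ N<r) triangular)
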